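{- Let $\Gamma$ be a connected cubic girth-regular graph of girth $5$. Then either the signature of $\Gamma$ is $(0,1,1)$ and $\Gamma\cong\mathrm{Tr}(\Lambda,\leftrightarrow)$ for some $5$-regular graph $\Lambda$ (possibly with parallel edges) and some dihedral scheme $\leftrightarrow$ on $\Lambda$, or $\Gamma$ is isomorphic to the Petersen graph or to the dodecahedron graph.
   Context: $\Gamma$ is a finite simple graph; cubic means $3$-regular. For a graph of finite girth $g$, a girth cycle is a cycle of length $g$, and $\epsilon(e)$ is the number of girth cycles containing the edge $e$. The signature of a vertex $v$ with incident edges $e_1,\ldots,e_k$ ordered so that $\epsilon(e_1)\le\cdots\le\epsilon(e_k)$ is $(\epsilon(e_1),\ldots,\epsilon(e_k))$; a graph is girth-regular if all vertices have the same signature (the signature of the graph). A graph with parallel edges and loops is $(V,E,\partial)$ with $\partial:E\to\{X\subseteq V:|X|\le2\}$; each edge consists of two mutually inverse arcs with tails; $\mathrm{out}(u)$ is the set of arcs with tail $u$, and $5$-regular means $|\mathrm{out}(u)|=5$ for all $u$. A dihedral scheme on $\Lambda$ is an irreflexive symmetric relation $\leftrightarrow$ on the arc set such that (arcs, $\leftrightarrow$) is a $2$-regular simple graph whose components are exactly the sets $\mathrm{out}(u)$. $\mathrm{Tr}(\Lambda,\leftrightarrow)$ is the simple graph on the arcs of $\Lambda$ with $s,t$ adjacent iff $s\leftrightarrow t$ or $s,t$ are mutually inverse. -}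

module Defs where

open import Data.Nat using (ℕ; zero; suc; _+_; _∸_; _<_; _≡ᵇ_; _<ᵇ_; _%_)
open import Data.Nat.Properties using (≤-decTotalOrder)
open import Data.Bool using (Bool; true; false; _∧_; _∨_; not)
open import Data.Fin using (Fin; toℕ; _≟_)
open import Data.List using (List; []; _∷_; _++_; length; map; concatMap; filterᵇ; allFin)
open import Data.Product using (Σ; _×_; _,_; proj₁; proj₂)
open import Data.Product.Properties using (≡-dec)
import Data.Bool.Properties as BoolP
open import Relation.Nullary.Decidable using (⌊_⌋)
open import Relation.Binary.PropositionalEquality using (_≡_)
open import Relation.Binary.Construct.Closure.ReflexiveTransitive using (Star)
open import Function.Bundles using (_↔_; Inverse)
open import Data.List.Sort ≤-decTotalOrder using (sort)

record Graph : Set where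
  field
    n     : ℕ
    adj   : Fin n → Fin n → Bool
    sym   : ∀ u v → adj u v ≡ adj v u
    irr   : ∀ u → adj u u ≡ false

module _ (Γ : Graph) where
  open Graph Γ

  Edge : Fin n → Fin n → Set
  Edge u v = adj u v ≡ true

  Connected : Set
  Connected = ∀ u v → Star Edge u v

  neighbours : Fin n → List (Fin n)
  neighbours v = filterᵇ (adj v) (allFin n)

  degree : Fin n → ℕ
  degree v = length (neighbours v)

  Cubic : Set
  Cubic = ∀ v → degree v ≡ 3

  walkᵇ : List (Fin n) → Bool
  walkᵇ []            = true
  walkᵇ (x ∷ [])      = true
  walkᵇ (x ∷ y ∷ xs)  = adj x y ∧ walkᵇ (y ∷ xs)

  closedWalkᵇ : List (Fin n) → Bool
  closedWalkᵇ []       = false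
  closedWalkᵇ (x ∷ xs) = walkᵇ (x ∷ xs ++ x ∷ [])

  notInᵇ : Fin n → List (Fin n) → Bool
  notInᵇ x []       = true
  notInᵇ x (y ∷ ys) = not ⌊ x ≟ y ⌋ ∧ notInᵇ x ys

  distinctᵇ : List (Fin n) → Bool
  distinctᵇ []       = true
  distinctᵇ (x ∷ xs) = notInᵇ x xs ∧ distinctᵇ xs

  isCycleᵇ : ℕ → List (Fin n) → Bool
  isCycleᵇ k vs = (length vs ≡ᵇ k) ∧ (2 <ᵇ k) ∧ distinctᵇ vs ∧ closedWalkᵇ vs

  Girth : ℕ → Set
  Girth g = Σ (List (Fin n)) (λ vs → isCycleᵇ g vs ≡ true)
          × (∀ k (vs : List (Fin n)) → k < g → isCycleᵇ k vs ≡ false)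

  lists : ℕ → List (List (Fin n))
  lists zero    = [] ∷ []
  lists (suc k) = concatMap (λ x → map (x ∷_) (lists k)) (allFin n)

  startsWithᵇ : Fin n → Fin n → List (Fin n) → Bool
  startsWithᵇ u w (a ∷ b ∷ _) = ⌊ a ≟ u ⌋ ∧ ⌊ b ≟ w ⌋
  startsWithᵇ u w _           = false

  -- ε g u w : number of cycles of length g containing the edge {u,w}.
  -- Each such cycle is counted exactly once, namely by its unique
  -- vertex sequence (v₀,v₁,…,v_{g-1}) with v₀ = u, v₁ = w.
  ε : ℕ → Fin n → Fin n → ℕ
  ε g u w = length (filterᵇ (λ vs → isCycleᵇ g vs ∧ startsWithᵇ u w vs) (lists g))

  signature : ℕ → Fin n → List ℕ
  signature g v = sort (map (ε g v) (neighbours v))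

  GirthRegular : Set
  GirthRegular = Σ ℕ (λ g → Girth g × (∀ u v → signature g u ≡ signature g v))

  IsoTo : (A : Set) → (A → A → Bool) → Set
  IsoTo A adjA = Σ (Fin n ↔ A) (λ f →
    ∀ u v → adj u v ≡ adjA (Inverse.to f u) (Inverse.to f v))

-- Graphs with parallel edges and loops: (V, E, ∂) with V = Fin nV,
-- E = Fin nE and ∂ e = {proj₁ (ends e), proj₂ (ends e)}.
-- The edge e consists of the two mutually inverse arcs (e , false) and
-- (e , true), with tails proj₁ (ends e) and proj₂ (ends e) respectively.

record Multigraph : Set where
  field
    nV   : ℕ
    nE   : ℕ
    ends : Fin nE → Fin nV × Fin nV

module _ (Λ : Multigraph) where
  open Multigraph Λ

  Arc : Set
  Arc = Fin nE × Bool

  tail : Arc → Fin nV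
  tail (e , false) = proj₁ (ends e)
  tail (e , true)  = proj₂ (ends e)

  inv : Arc → Arc
  inv (e , b) = (e , not b)

  allArcs : List Arc
  allArcs = concatMap (λ e → (e , false) ∷ (e , true) ∷ []) (allFin nE)

  _≟A_ : (a b : Arc) → _
  _≟A_ = ≡-dec _≟_ BoolP._≟_

  out : Fin nV → List Arc
  out u = filterᵇ (λ a → ⌊ tail a ≟ u ⌋) allArcs

  FiveRegular : Set
  FiveRegular = ∀ u → length (out u) ≡ 5

  record DihedralScheme : Set where
    field
      rel      : Arc → Arc → Bool
      irrefl   : ∀ a → rel a a ≡ false
      symm     : ∀ a b → rel a b ≡ rel b a
      twoReg   : ∀ a → length (filterᵇ (rel a) allArcs) ≡ 2
      compSub  : ∀ a b → Star (λ x y → rel x y ≡ true) a b → tail a ≡ tail b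
      compSup  : ∀ a b → tail a ≡ tail b → Star (λ x y → rel x y ≡ true) a b

  TrAdj : DihedralScheme → Arc → Arc → Bool
  TrAdj D s t = DihedralScheme.rel D s t ∨ ⌊ inv s ≟A t ⌋

-- Generalised Petersen graph GP(N,K) on vertices 0..2N-1:
-- outer i ~ i+1 (mod N), spokes i ~ N+i, inner N+i ~ N+(i+K mod N).

gpEdgeᵇ : (N K : ℕ) → ℕ → ℕ → Bool
gpEdgeᵇ zero    K a b = false
gpEdgeᵇ (suc M) K a b =
     ((a <ᵇ N) ∧ (b <ᵇ N) ∧ (b ≡ᵇ ((a + 1) % N)))
   ∨ ((a <ᵇ N) ∧ (b ≡ᵇ (a + N)))
   ∨ (not (a <ᵇ N) ∧ not (b <ᵇ N) ∧ ((b ∸ N) ≡ᵇ (((a ∸ N) + K) % N)))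
  where N = suc M

gpAdj : (N K : ℕ) → ℕ → ℕ → Bool
gpAdj N K a b = gpEdgeᵇ N K a b ∨ gpEdgeᵇ N K b a

petersenAdj : Fin 10 → Fin 10 → Bool
petersenAdj i j = gpAdj 5 2 (toℕ i) (toℕ j)

dodecahedronAdj : Fin 20 → Fin 20 → Bool
dodecahedronAdj i j = gpAdj 10 2 (toℕ i) (toℕ j)

{-# OPTIONS --safe #-}
module Submission where

-- For a path u, v, w of length 2 let C be the number of pentagons through it; as there are no
-- 4-cycles, C ≤ 2.  The three values of C at a vertex have the values of ε as pair sums, so
-- girth-regularity makes the sorted triple (X, Y, Z) of these values the same at every vertex.
-- If (2,2,2) or (1,1,1), extending outwards from a pentagon yields a cover of Γ by the Petersen
-- graph or by the dodecahedron, and it is injective because short paths cannot be closed up.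
-- If exactly one edge at each vertex has a distinguished value of ε, these edges form a perfect
-- matching.  For (0,Y,Z) with Y > 0 it alternates around a pentagon, which is absurd; (0,0,2),
-- (1,1,2) and (1,2,2) are excluded by following pentagons for a few steps; for (0,0,1) each
-- vertex lies on one pentagon, and contracting the pentagons gives Λ.

open import Defs
open import Data.Nat using (ℕ; zero; suc; _+_; _*_; _≤_; z≤n; s≤s)
open import Data.Nat.Properties using (+-comm; +-identityʳ; ≤-decTotalOrder; ≤-totalOrder; +-monoʳ-≤; +-mono-≤; ≤-total; ≤-refl; ≤-reflexive; ≤-trans; *-cancelˡ-≡; +-cancelʳ-≡; <-cmp)
open import Data.Nat.ListAction using (sum)
open import Data.Nat.ListAction.Properties using (sum-↭)
open import Data.Nat.Tactic.RingSolver using (solve-∀)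
open import Data.Bool using (Bool; true; false; _∧_; _∨_; not; if_then_else_)
open import Data.Bool.Properties using (T-≡; T?; ¬-not; not-¬; ∨-zeroʳ)
open import Data.Bool.ListAction using (and; any)
open import Data.Fin using (Fin; zero; suc; _≟_; _<?_; #_)
open import Data.Fin.Properties as Fin using (any?; suc-injective)
open import Data.List using (List; []; _∷_; _++_; length; map; concatMap; filterᵇ; allFin; cartesianProductWith)
open import Data.List.Properties using (length-++; length-map; ∷-injective)
open import Data.List.Membership.Propositional using (_∈_)
open import Data.List.Membership.DecPropositional using () renaming (_∈?_ to dec-∈?)
open import Data.List.Membership.Propositional.Properties using (∈-filter⁺; ∈-filter⁻; ∈-allFin; ∈-map⁺; ∈-map⁻; ∈-++⁺ˡ; ∈-++⁺ʳ; ∈-++⁻; ∈-cartesianProductWith⁺)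
open import Data.List.Membership.Propositional.Properties.WithK using (unique∧set⇒bag)
open import Data.List.Sort ≤-decTotalOrder using (sort; sort-↭; sort-↗)
open import Data.List.Relation.Unary.Any using (here; there)
open import Data.List.Relation.Unary.All using (All; []; _∷_)
open import Data.List.Relation.Unary.AllPairs using ([]; _∷_)
open import Data.List.Relation.Unary.Linked using ([-]; _∷_)
open import Data.List.Relation.Unary.Sorted.TotalOrder.Properties using (↗↭↗⇒≋)
open import Data.List.Relation.Unary.Unique.Propositional using (Unique)
import Data.List.Relation.Unary.Unique.Propositional.Properties as Unique
open import Data.List.Relation.Binary.BagAndSetEquality using (∼bag⇒↭)
open import Data.List.Relation.Binary.Pointwise using (Pointwise-≡⇒≡)
open import Data.List.Relation.Binary.Permutation.Propositional using (_↭_; ↭-trans; ↭⇒↭ₛ; ↭-reflexive)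
open import Data.List.Relation.Binary.Permutation.Propositional.Properties using (↭-length) renaming (map⁺ to map-↭)
open import Data.Vec using (Vec; []; _∷_; lookup)
open import Data.Product using (Σ; ∃; ∃₂; _×_; _,_; proj₁; proj₂)
open import Data.Sum using (_⊎_; inj₁; inj₂)
open import Data.Empty using (⊥; ⊥-elim)
open import Function.Base using (_∘_)
open import Function.Bundles using (Equivalence; Inverse; _↔_; mk⇔; mk↔ₛ′)
open import Relation.Nullary using (¬_; Dec; yes; no; contradiction)
open import Relation.Nullary.Decidable using (⌊_⌋; map′; _⊎-dec_)
open import Relation.Binary.Definitions using (tri<; tri≈; tri>)
open import Relation.Binary.PropositionalEquality using (_≡_; _≢_; refl; sym; trans; cong; cong₂; subst; subst₂; module ≡-Reasoning)
open import Relation.Binary.Construct.Closure.ReflexiveTransitive using (Star; _◅_; _◅◅_; gmap; reverse) renaming (ε to ε⋆)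

-- The values of `C` belong to paths centred at one vertex, whereas `ε` belongs to an edge and looks
-- the same from both ends. Hence a value of `C` that differs from the other two is used through
-- `ε`: the edge off that path then has a value of `ε` shared by neither other edge at the vertex,
-- and it is distinguished at both of its ends. The other tool is that each of the two continuations
-- of a path of length 2 lies on at most one pentagon: `C` = 2 forces both to close up, `C` = 1
-- exactly one, `C` = 0 none. The local arguments play these alternatives against triangles and
-- 4-cycles. If the three values agree, no edge is distinguished and `Γ` has to be rebuilt globally.
-- A cover alone does not decide `Γ`: the Petersen graph is the antipodal quotient of the
-- dodecahedron and also has girth 5. Girth separates the images of vertices at distance at most 4;
-- antipodal vertices of the dodecahedron, at distance 5, need the uniqueness of the pentagon
-- through a path of length 2.

∧-true⁻ : ∀ {a b} → a ∧ b ≡ true → a ≡ true × b ≡ true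
∧-true⁻ {true} {true} _ = refl , refl

∧-true⁺ : ∀ {a b} → a ≡ true → b ≡ true → a ∧ b ≡ true
∧-true⁺ refl refl = refl

∨-true⁻ : ∀ {a b} → a ∨ b ≡ true → a ≡ true ⊎ b ≡ true
∨-true⁻ {true}  _ = inj₁ refl
∨-true⁻ {false} p = inj₂ p

≡-from-⇔ : ∀ {a b} → (a ≡ true → b ≡ true) → (b ≡ true → a ≡ true) → a ≡ b
≡-from-⇔ {true}          f g = sym (f refl)
≡-from-⇔ {false} {true}  f g = g refl
≡-from-⇔ {false} {false} f g = refl

dec-yes : {P : Set} (d : Dec P) → P → ⌊ d ⌋ ≡ true
dec-yes (yes _) p = refl
dec-yes (no ¬p) p = contradiction p ¬p

dec-yes⁻ : {P : Set} (d : Dec P) → ⌊ d ⌋ ≡ true → P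
dec-yes⁻ (yes p) _ = p

dec-no : {P : Set} (d : Dec P) → ¬ P → not ⌊ d ⌋ ≡ true
dec-no (yes p) ¬p = contradiction p ¬p
dec-no (no _)  ¬p = refl

dec-no⁻ : {P : Set} (d : Dec P) → not ⌊ d ⌋ ≡ true → ¬ P
dec-no⁻ (no ¬p) _ = ¬p

⌊⌋-true⁺ : ∀ {n} {i j : Fin n} → i ≡ j → ⌊ i ≟ j ⌋ ≡ true
⌊⌋-true⁺ {i = i} {j} = dec-yes (i ≟ j)

⌊⌋-true⁻ : ∀ {n} {i j : Fin n} → ⌊ i ≟ j ⌋ ≡ true → i ≡ j
⌊⌋-true⁻ {i = i} {j} = dec-yes⁻ (i ≟ j)

not⌊⌋-true⁺ : ∀ {n} {i j : Fin n} → i ≢ j → not ⌊ i ≟ j ⌋ ≡ true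
not⌊⌋-true⁺ {i = i} {j} = dec-no (i ≟ j)

not⌊⌋-true⁻ : ∀ {n} {i j : Fin n} → not ⌊ i ≟ j ⌋ ≡ true → i ≢ j
not⌊⌋-true⁻ {i = i} {j} = dec-no⁻ (i ≟ j)

bit : Bool → ℕ
bit true  = 1
bit false = 0

-- Filtered lists and counting

module _ {A : Set} where

  ∈-filterᵇ⁺ : (p : A → Bool) {x : A} {xs : List A} → x ∈ xs → p x ≡ true → x ∈ filterᵇ p xs
  ∈-filterᵇ⁺ p x∈ px = ∈-filter⁺ (T? ∘ p) x∈ (Equivalence.from T-≡ px)

  ∈-filterᵇ⁻ : (p : A → Bool) {x : A} {xs : List A} → x ∈ filterᵇ p xs → x ∈ xs × p x ≡ true
  ∈-filterᵇ⁻ p x∈ with ∈-filter⁻ (T? ∘ p) x∈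
  ... | x∈xs , px = x∈xs , Equivalence.to T-≡ px

  filterᵇ-unique : (p : A → Bool) {xs : List A} → Unique xs → Unique (filterᵇ p xs)
  filterᵇ-unique p = Unique.filter⁺ (T? ∘ p)

  unique-↭ : {xs ys : List A} → Unique xs → Unique ys →
             (∀ {x} → x ∈ xs → x ∈ ys) → (∀ {x} → x ∈ ys → x ∈ xs) → xs ↭ ys
  unique-↭ xs! ys! f g = ∼bag⇒↭ (unique∧set⇒bag xs! ys! (mk⇔ f g))

  -- Degrees, cycle numbers and arc numbers are all lengths of filtered enumerations. This is how
  -- they are evaluated: by an explicit list without repetitions that has the same members.
  filterᵇ-↭ : (p : A → Bool) {xs ys : List A} → Unique xs → Unique ys →
              (∀ {x} → x ∈ xs → p x ≡ true → x ∈ ys) →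
              (∀ {x} → x ∈ ys → x ∈ xs × p x ≡ true) → filterᵇ p xs ↭ ys
  filterᵇ-↭ p xs! ys! f g = unique-↭ (filterᵇ-unique p xs!) ys!
    (λ x∈ → let x∈xs , px = ∈-filterᵇ⁻ p x∈ in f x∈xs px)
    (λ x∈ → let x∈xs , px = g x∈ in ∈-filterᵇ⁺ p x∈xs px)

  length-filterᵇ : (p : A → Bool) (xs : List A) → length (filterᵇ p xs) ≡ sum (map (bit ∘ p) xs)
  length-filterᵇ p [] = refl
  length-filterᵇ p (x ∷ xs) with p x
  ... | true  = cong suc (length-filterᵇ p xs)
  ... | false = length-filterᵇ p xs

concatMap-map : {A B C : Set} (f : A → B → C) (xs : List A) (ys : List B) →
                concatMap (λ x → map (f x) ys) xs ≡ cartesianProductWith f xs ys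
concatMap-map f []       ys = refl
concatMap-map f (x ∷ xs) ys = cong (map (f x) ys ++_) (concatMap-map f xs ys)

unique₃ : {A : Set} {x y z : A} → x ≢ y → x ≢ z → y ≢ z → Unique (x ∷ y ∷ z ∷ [])
unique₃ xy xz yz = (xy ∷ xz ∷ []) ∷ (yz ∷ []) ∷ [] ∷ []

-- Neighbourhoods and pentagons in a cubic graph of girth 5

module CubicGirth₅ (Γ : Graph) (cubic : Cubic Γ) (girth : Girth Γ 5) where

  open Graph Γ public using (n; adj; irr) renaming (sym to adj-sym)

  V : Set
  V = Fin n

  E : V → V → Set
  E = Edge Γ

  E-sym : ∀ {u v} → E u v → E v u
  E-sym {u} {v} e = trans (adj-sym v u) e

  E-irr : ∀ {u v} → E u v → u ≢ v
  E-irr {u} e refl with trans (sym e) (irr u)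
  ... | ()

  -- A labelled triple instead of a list of neighbours: the names can be permuted freely, and up to
  -- three of them can be prescribed by `N3-with₁`, `N3-with₂`, `N3-with₃`.
  record N3 (v x y z : V) : Set where
    constructor n3
    field
      ex : E v x
      ey : E v y
      ez : E v z
      x≢y : x ≢ y
      x≢z : x ≢ z
      y≢z : y ≢ z
      cover : ∀ {w} → E v w → w ≡ x ⊎ w ≡ y ⊎ w ≡ z

  N3-swap₁₂ : ∀ {v x y z} → N3 v x y z → N3 v y x z
  N3-swap₁₂ (n3 ex ey ez xy xz yz c) = n3 ey ex ez (xy ∘ sym) yz xz
    λ e → case (c e)
    where
    case : ∀ {w x y z : V} → w ≡ x ⊎ w ≡ y ⊎ w ≡ z → w ≡ y ⊎ w ≡ x ⊎ w ≡ z
    case (inj₁ p)        = inj₂ (inj₁ p)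
    case (inj₂ (inj₁ p)) = inj₁ p
    case (inj₂ (inj₂ p)) = inj₂ (inj₂ p)

  N3-rot : ∀ {v x y z} → N3 v x y z → N3 v y z x
  N3-rot (n3 ex ey ez xy xz yz c) = n3 ey ez ex yz (xy ∘ sym) (xz ∘ sym)
    λ e → case (c e)
    where
    case : ∀ {w x y z : V} → w ≡ x ⊎ w ≡ y ⊎ w ≡ z → w ≡ y ⊎ w ≡ z ⊎ w ≡ x
    case (inj₁ p)        = inj₂ (inj₂ p)
    case (inj₂ (inj₁ p)) = inj₁ p
    case (inj₂ (inj₂ p)) = inj₂ (inj₁ p)

  N3-swap₂₃ : ∀ {v x y z} → N3 v x y z → N3 v x z y
  N3-swap₂₃ = N3-swap₁₂ ∘ N3-rot ∘ N3-rot

  neighbours-unique : ∀ v → Unique (neighbours Γ v)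
  neighbours-unique v = filterᵇ-unique (adj v) (Unique.allFin⁺ n)

  N3-any : ∀ v → ∃ λ x → ∃₂ λ y z → N3 v x y z
  N3-any v = from-list (neighbours Γ v) (cubic v) (neighbours-unique v)
      (λ {w} e → ∈-filterᵇ⁺ (adj v) (∈-allFin w) e)
      (λ w∈ → proj₂ (∈-filterᵇ⁻ (adj v) {xs = allFin n} w∈))
    where
    from-list : (l : List V) → length l ≡ 3 → Unique l →
                (∀ {w} → E v w → w ∈ l) → (∀ {w} → w ∈ l → E v w) →
                ∃ λ x → ∃₂ λ y z → N3 v x y z
    from-list (x ∷ y ∷ z ∷ []) refl ((xy ∷ xz ∷ []) ∷ (yz ∷ []) ∷ _) f g =
      x , y , z , n3 (g (here refl)) (g (there (here refl))) (g (there (there (here refl))))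
        xy xz yz (case ∘ f)
      where
      case : ∀ {w} → w ∈ (x ∷ y ∷ z ∷ []) → w ≡ x ⊎ w ≡ y ⊎ w ≡ z
      case (here p) = inj₁ p
      case (there (here p)) = inj₂ (inj₁ p)
      case (there (there (here p))) = inj₂ (inj₂ p)

  N3-with₁ : ∀ {v x} → E v x → ∃₂ λ y z → N3 v x y z
  N3-with₁ {v} e with N3-any v
  ... | _ , _ , _ , t with N3.cover t e
  ... | inj₁ refl        = _ , _ , t
  ... | inj₂ (inj₁ refl) = _ , _ , N3-rot t
  ... | inj₂ (inj₂ refl) = _ , _ , N3-rot (N3-rot t)

  N3-with₂ : ∀ {v x y} → E v x → E v y → x ≢ y → ∃ λ z → N3 v x y z
  N3-with₂ e f x≢y with N3-with₁ e
  ... | _ , _ , t with N3.cover t f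
  ... | inj₁ y≡x         = contradiction (sym y≡x) x≢y
  ... | inj₂ (inj₁ refl) = _ , t
  ... | inj₂ (inj₂ refl) = _ , N3-swap₂₃ t

  N3-with₃ : ∀ {v x y z} → E v x → E v y → E v z → x ≢ y → x ≢ z → y ≢ z → N3 v x y z
  N3-with₃ e f g xy xz yz with N3-with₂ e f xy
  ... | _ , t with N3.cover t g
  ... | inj₁ z≡x         = contradiction (sym z≡x) xz
  ... | inj₂ (inj₁ z≡y)  = contradiction (sym z≡y) yz
  ... | inj₂ (inj₂ refl) = t

  N3-↭ : ∀ {v x y z} → N3 v x y z → neighbours Γ v ↭ (x ∷ y ∷ z ∷ [])
  N3-↭ {v} {x} {y} {z} (n3 ex ey ez xy xz yz c) =
    filterᵇ-↭ (adj v) (Unique.allFin⁺ n) (unique₃ xy xz yz)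
      (λ _ e → case (c e))
      (λ { (here refl)                 → ∈-allFin x , ex
         ; (there (here refl))         → ∈-allFin y , ey
         ; (there (there (here refl))) → ∈-allFin z , ez })
    where
    case : ∀ {w} → w ≡ x ⊎ w ≡ y ⊎ w ≡ z → w ∈ (x ∷ y ∷ z ∷ [])
    case (inj₁ p)        = here p
    case (inj₂ (inj₁ p)) = there (here p)
    case (inj₂ (inj₂ p)) = there (there (here p))

  sum-neighbours : ∀ {v x y z} (f : V → ℕ) → N3 v x y z →
                   sum (map f (neighbours Γ v)) ≡ f x + (f y + f z)
  sum-neighbours {v} {x} {y} {z} f t = trans (sum-↭ (map-↭ f (N3-↭ t)))
    (cong (λ s → f x + (f y + s)) (+-identityʳ (f z)))

  no-triangle : ∀ {a b c} → E a b → E b c → E c a → ⊥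
  no-triangle {a} {b} {c} ab bc ca
    with trans (sym (proj₂ girth 3 (a ∷ b ∷ c ∷ []) (s≤s (s≤s (s≤s (s≤s z≤n))))))
      (∧-true⁺ (∧-true⁺ (∧-true⁺ (not⌊⌋-true⁺ (E-irr ab)) (∧-true⁺ (not⌊⌋-true⁺ (E-irr ca ∘ sym)) refl))
                (∧-true⁺ (∧-true⁺ (not⌊⌋-true⁺ (E-irr bc)) refl) refl))
        (∧-true⁺ ab (∧-true⁺ bc (∧-true⁺ ca refl))))
  ... | ()

  no-square : ∀ {a b c d} → E a b → E b c → E c d → E d a → a ≢ c → b ≢ d → ⊥
  no-square {a} {b} {c} {d} ab bc cd da ac bd
    with trans (sym (proj₂ girth 4 (a ∷ b ∷ c ∷ d ∷ []) (s≤s (s≤s (s≤s (s≤s (s≤s z≤n)))))))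
      (∧-true⁺ (∧-true⁺ (∧-true⁺ (not⌊⌋-true⁺ (E-irr ab)) (∧-true⁺ (not⌊⌋-true⁺ ac) (∧-true⁺ (not⌊⌋-true⁺ (E-irr da ∘ sym)) refl)))
                (∧-true⁺ (∧-true⁺ (not⌊⌋-true⁺ (E-irr bc)) (∧-true⁺ (not⌊⌋-true⁺ bd) refl))
                 (∧-true⁺ (∧-true⁺ (not⌊⌋-true⁺ (E-irr cd)) refl) refl)))
        (∧-true⁺ ab (∧-true⁺ bc (∧-true⁺ cd (∧-true⁺ da refl)))))
  ... | ()

  record Pentagon (a b c d e : V) : Set where
    constructor pentagon
    field
      ab : E a b
      bc : E b c
      cd : E c d
      de : E d e
      ea : E e a
      a≢c : a ≢ c
      b≢d : b ≢ d
      c≢e : c ≢ e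
      d≢a : d ≢ a
      e≢b : e ≢ b

  Pentagon-rot : ∀ {a b c d e} → Pentagon a b c d e → Pentagon b c d e a
  Pentagon-rot (pentagon ab bc cd de ea ac bd ce da eb) = pentagon bc cd de ea ab bd ce da eb ac

  -- A closed walk of length 5 is a cycle as there are no triangles.
  Pentagon-closed : ∀ {a b c d e} → E a b → E b c → E c d → E d e → E e a → Pentagon a b c d e
  Pentagon-closed ab bc cd de ea = pentagon ab bc cd de ea
    (λ { refl → no-triangle cd de ea })
    (λ { refl → no-triangle de ea ab })
    (λ { refl → no-triangle ea ab bc })
    (λ { refl → no-triangle ab bc cd })
    (λ { refl → no-triangle bc cd de })

  isCycle⇒Pentagon : ∀ l → isCycleᵇ Γ 5 l ≡ true →
    Σ V λ a → Σ V λ b → Σ V λ c → Σ V λ d → Σ V λ e → l ≡ a ∷ b ∷ c ∷ d ∷ e ∷ [] × Pentagon a b c d e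
  isCycle⇒Pentagon (a ∷ b ∷ c ∷ d ∷ e ∷ []) p =
    let _ , w  = ∧-true⁻ {distinctᵇ Γ (a ∷ b ∷ c ∷ d ∷ e ∷ [])} p
        ab , w = ∧-true⁻ w
        bc , w = ∧-true⁻ w
        cd , w = ∧-true⁻ w
        de , w = ∧-true⁻ w
        ea , _ = ∧-true⁻ {adj e a} w
    in a , b , c , d , e , refl , Pentagon-closed ab bc cd de ea

  Pentagon⇒isCycle : ∀ {a b c d e} → Pentagon a b c d e → isCycleᵇ Γ 5 (a ∷ b ∷ c ∷ d ∷ e ∷ []) ≡ true
  Pentagon⇒isCycle (pentagon ab bc cd de ea ac bd ce da eb) =
    ∧-true⁺ (∧-true⁺ (notIn₄ (E-irr ab) ac (da ∘ sym) (E-irr ea ∘ sym))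
            (∧-true⁺ (∧-true⁺ (not⌊⌋-true⁺ (E-irr bc)) (∧-true⁺ (not⌊⌋-true⁺ bd) (∧-true⁺ (not⌊⌋-true⁺ (eb ∘ sym)) refl)))
            (∧-true⁺ (∧-true⁺ (not⌊⌋-true⁺ (E-irr cd)) (∧-true⁺ (not⌊⌋-true⁺ ce) refl))
            (∧-true⁺ (∧-true⁺ (not⌊⌋-true⁺ (E-irr de)) refl) refl))))
      (∧-true⁺ ab (∧-true⁺ bc (∧-true⁺ cd (∧-true⁺ de (∧-true⁺ ea refl)))))
    where
    notIn₄ : ∀ {a b c d e : V} → a ≢ b → a ≢ c → a ≢ d → a ≢ e → notInᵇ Γ a (b ∷ c ∷ d ∷ e ∷ []) ≡ true
    notIn₄ p q r s = ∧-true⁺ (not⌊⌋-true⁺ p) (∧-true⁺ (not⌊⌋-true⁺ q) (∧-true⁺ (not⌊⌋-true⁺ r) (∧-true⁺ (not⌊⌋-true⁺ s) refl)))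

  some-pentagon : Σ V λ a → Σ V λ b → Σ V λ c → Σ V λ d → Σ V λ e → Pentagon a b c d e
  some-pentagon with proj₁ girth
  ... | l , p with isCycle⇒Pentagon l p
  ... | a , b , c , d , e , _ , P = a , b , c , d , e , P

  -- The counts `β`, `C` and `ε₅`

  e₁ : V → V → ℕ
  e₁ u v = bit (adj u v)

  abstract
    -- Number of common neighbours.
    β : V → V → ℕ
    β a b = sum (map (λ x → e₁ x b) (neighbours Γ a))

    β-N3 : ∀ {a b x y z} → N3 a x y z → β a b ≡ e₁ x b + (e₁ y b + e₁ z b)
    β-N3 = sum-neighbours _

    β-length : ∀ a b → length (filterᵇ (λ x → adj x b) (neighbours Γ a)) ≡ β a b
    β-length a b = length-filterᵇ (λ x → adj x b) (neighbours Γ a)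

  E? : ∀ u v → Dec (E u v)
  E? u v = adj u v Data.Bool.≟ true

  e₁-yes : ∀ {u v} → E u v → e₁ u v ≡ 1
  e₁-yes e = cong bit e

  e₁-no : ∀ {u v} → ¬ E u v → e₁ u v ≡ 0
  e₁-no {u} {v} ¬e with adj u v
  ... | true  = contradiction refl ¬e
  ... | false = refl

  e₁-sym : ∀ u v → e₁ u v ≡ e₁ v u
  e₁-sym u v = cong bit (adj-sym u v)

  -- In the absence of triangles, a path a, u, v, b lies on a pentagon iff Good a b.
  Good : V → V → Set
  Good a b = ∃ λ x → E a x × E x b

  Good-sym : ∀ {a b} → Good a b → Good b a
  Good-sym (x , ax , xb) = x , E-sym xb , E-sym ax

  -- A second common neighbour would close a 4-cycle.
  β-yes : ∀ {a b} → Good a b → a ≢ b → β a b ≡ 1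
  β-yes {a} {b} (x , ax , xb) a≢b with N3-with₁ ax
  ... | y , z , t = trans (β-N3 t)
    (cong₂ _+_ (e₁-yes xb) (cong₂ _+_
      (e₁-no (λ yb → no-square ax xb (E-sym yb) (E-sym (N3.ey t)) a≢b (N3.x≢y t)))
      (e₁-no (λ zb → no-square ax xb (E-sym zb) (E-sym (N3.ez t)) a≢b (N3.x≢z t)))))

  Good? : ∀ a b → Dec (Good a b)
  Good? a b with N3-any a
  ... | x , y , z , t with E? x b | E? y b | E? z b
  ... | yes e | _ | _ = yes (x , N3.ex t , e)
  ... | no _ | yes e | _ = yes (y , N3.ey t , e)
  ... | no _ | no _ | yes e = yes (z , N3.ez t , e)
  ... | no ¬x | no ¬y | no ¬z = no λ (w , aw , wb) → case (N3.cover t aw) wb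
    where
    case : ∀ {w} → w ≡ x ⊎ w ≡ y ⊎ w ≡ z → ¬ E w b
    case (inj₁ refl) = ¬x
    case (inj₂ (inj₁ refl)) = ¬y
    case (inj₂ (inj₂ refl)) = ¬z

  β-no : ∀ {a b} → ¬ Good a b → β a b ≡ 0
  β-no {a} {b} ¬g with N3-any a
  ... | x , y , z , t = trans (β-N3 t)
    (cong₂ _+_ (e₁-no (λ e → ¬g (x , N3.ex t , e))) (cong₂ _+_
      (e₁-no (λ e → ¬g (y , N3.ey t , e)))
      (e₁-no (λ e → ¬g (z , N3.ez t , e)))))

  β-sym : ∀ {a b} → a ≢ b → β a b ≡ β b a
  β-sym {a} {b} a≢b with Good? a b
  ... | yes g = trans (β-yes g a≢b) (sym (β-yes (Good-sym g) (a≢b ∘ sym)))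
  ... | no ¬g = trans (β-no ¬g) (sym (β-no (¬g ∘ Good-sym)))

  abstract
    -- Number of pentagons through the path a, u, v, sorted by the vertex b following v.
    C : V → V → V → ℕ
    C a u v = sum (map (λ b → if ⌊ b ≟ u ⌋ then 0 else β a b) (neighbours Γ v))

    C-β : ∀ {a u v b b′} → N3 v u b b′ → C a u v ≡ β a b + β a b′
    C-β {a} {u} {v} {b} {b′} t = trans (sum-neighbours _ t)
      (cong₂ _+_ (if-true {k = β a u} (⌊⌋-true⁺ {i = u} refl))
        (cong₂ _+_ (if-false (N3.x≢y t ∘ sym)) (if-false (N3.x≢z t ∘ sym))))
      where
      if-true : ∀ {p k} → p ≡ true → (if p then 0 else k) ≡ 0
      if-true refl = refl
      if-false : ∀ {b} → b ≢ u → (if ⌊ b ≟ u ⌋ then 0 else β a b) ≡ β a b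
      if-false {b} b≢u with b ≟ u
      ... | yes p = contradiction p b≢u
      ... | no _  = refl

  path-ends : ∀ {a u v b} → E a u → E u v → E v b → a ≢ b
  path-ends au uv vb refl = no-triangle au uv vb

  -- Both sides count the adjacent pairs made of a neighbour of `a` and a neighbour of `v`, both
  -- other than `u` respectively the middle vertex; reading the path backwards exchanges the order
  -- of summation.
  C-sym : ∀ {a u v} → E a u → E u v → C a u v ≡ C v u a
  C-sym {a} {u} {v} au uv with N3-with₁ (E-sym uv) | N3-with₁ au
  ... | b , b′ , t | c , c′ , s = begin
    C a u v                                              ≡⟨ C-β t ⟩
    β a b + β a b′                                       ≡⟨ cong₂ _+_ (through au s (N3.ey t) uv) (through au s (N3.ez t) uv) ⟩
    (e₁ c b + e₁ c′ b) + (e₁ c b′ + e₁ c′ b′)            ≡⟨ cong₂ _+_ (cong₂ _+_ (e₁-sym c b) (e₁-sym c′ b)) (cong₂ _+_ (e₁-sym c b′) (e₁-sym c′ b′)) ⟩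
    (e₁ b c + e₁ b c′) + (e₁ b′ c + e₁ b′ c′)            ≡⟨ interchange (e₁ b c) _ _ _ ⟩
    (e₁ b c + e₁ b′ c) + (e₁ b c′ + e₁ b′ c′)            ≡⟨ cong₂ _+_ (through (E-sym uv) t (N3.ey s) (E-sym au)) (through (E-sym uv) t (N3.ez s) (E-sym au)) ⟨
    β v c + β v c′                                       ≡⟨ C-β s ⟨
    C v u a                                              ∎
    where
    open ≡-Reasoning
    interchange : ∀ p q r s → (p + q) + (r + s) ≡ (p + r) + (q + s)
    interchange = solve-∀
    -- The neighbour `u` of `a` contributes nothing to `β a b`, since `u`, `v`, `b` would form a
    -- triangle.
    through : ∀ {a u v b c c′} → E a u → N3 a u c c′ → E v b → E u v → β a b ≡ e₁ c b + e₁ c′ b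
    through au s vb uv = trans (β-N3 s)
      (cong (_+ _) (e₁-no (λ ub → no-triangle ub (E-sym vb) (E-sym uv))))

  lists-product : ∀ k → lists Γ (suc k) ≡ cartesianProductWith _∷_ (allFin n) (lists Γ k)
  lists-product k = concatMap-map _∷_ (allFin n) (lists Γ k)

  lists-unique : ∀ k → Unique (lists Γ k)
  lists-unique zero    = [] ∷ []
  lists-unique (suc k) = subst Unique (sym (lists-product k))
    (Unique.cartesianProductWith⁺ _∷_ (λ { refl → refl , refl }) (Unique.allFin⁺ n) (lists-unique k))

  lists-complete : ∀ l → l ∈ lists Γ (length l)
  lists-complete []      = here refl
  lists-complete (x ∷ l) = subst ((x ∷ l) ∈_) (sym (lists-product (length l)))
    (∈-cartesianProductWith⁺ _∷_ (∈-allFin x) (lists-complete l))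

  abstract
    ε₅ : V → V → ℕ
    ε₅ = ε Γ 5

    ε₅-def : ∀ u v → ε Γ 5 u v ≡ ε₅ u v
    ε₅-def u v = refl

  -- A pentagon through the edge enters `u` from exactly one of the two other neighbours, so the
  -- counts for the two paths ending in this edge add up.
  ε-C : ∀ {u v a a′} → N3 u v a a′ → ε₅ u v ≡ C a u v + C a′ u v
  ε-C {u} {v} {a} {a′} s with N3-with₁ (E-sym (N3.ex s))
  ... | b , b′ , t = begin
    ε₅ u v                                          ≡⟨ trans (sym (ε₅-def u v)) (↭-length (filterᵇ-↭ _ (lists-unique 5) cycles-unique ⊆-cycles cycles-⊆)) ⟩
    length cycles                                   ≡⟨ length-++ (cyc a b ++ cyc a b′) ⟩
    length (cyc a b ++ cyc a b′) + length (cyc a′ b ++ cyc a′ b′)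
                                                    ≡⟨ cong₂ _+_ (length₂ a) (length₂ a′) ⟩
    C a u v + C a′ u v                              ∎
    where
    open ≡-Reasoning
    -- The pentagons are grouped by the vertex before `u` and the vertex after `v`; what remains
    -- free is the vertex `x` opposite to the edge.
    cyc : V → V → List (List V)
    cyc a b = map (λ x → u ∷ v ∷ b ∷ x ∷ a ∷ []) (filterᵇ (λ x → adj x b) (neighbours Γ a))

    length-cyc : ∀ a b → length (cyc a b) ≡ β a b
    length-cyc a b = trans (length-map _ (filterᵇ (λ x → adj x b) (neighbours Γ a)))
      (β-length a b)

    length₂ : ∀ a → length (cyc a b ++ cyc a b′) ≡ C a u v
    length₂ a = trans (length-++ (cyc a b))
      (trans (cong₂ _+_ (length-cyc a b) (length-cyc a b′)) (sym (C-β t)))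

    ∈-cyc⁻ : ∀ {a b l} → l ∈ cyc a b → ∃ λ x → l ≡ u ∷ v ∷ b ∷ x ∷ a ∷ [] × E a x × E x b
    ∈-cyc⁻ {a} {b} l∈ with ∈-map⁻ _ l∈
    ... | x , x∈ , eq with ∈-filterᵇ⁻ (λ x → adj x b) {xs = neighbours Γ a} x∈
    ... | x∈N , xb = x , eq , proj₂ (∈-filterᵇ⁻ (adj a) {xs = allFin n} x∈N) , xb

    ∈-cyc⁺ : ∀ {a b x} → E a x → E x b → u ∷ v ∷ b ∷ x ∷ a ∷ [] ∈ cyc a b
    ∈-cyc⁺ {a} {b} {x} ax xb = ∈-map⁺ _ (∈-filterᵇ⁺ (λ x → adj x b)
      (∈-filterᵇ⁺ (adj a) (∈-allFin x) ax) xb)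

    cyc-unique : ∀ a b → Unique (cyc a b)
    cyc-unique a b = Unique.map⁺ (λ { refl → refl })
      (filterᵇ-unique (λ x → adj x b) (neighbours-unique a))

    cycles : List (List V)
    cycles = (cyc a b ++ cyc a b′) ++ (cyc a′ b ++ cyc a′ b′)

    row-unique : ∀ a → Unique (cyc a b ++ cyc a b′)
    row-unique a = Unique.++⁺ (cyc-unique a b) (cyc-unique a b′)
      λ (p , q) → clash (∈-cyc⁻ p) (∈-cyc⁻ q)
      where
      clash : ∀ {l} → (∃ λ x → l ≡ u ∷ v ∷ b ∷ x ∷ a ∷ [] × E a x × E x b) →
              (∃ λ x → l ≡ u ∷ v ∷ b′ ∷ x ∷ a ∷ [] × E a x × E x b′) → ⊥
      clash (_ , refl , _) (_ , refl , _) = N3.y≢z t refl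

    row-end : ∀ {a l} → l ∈ cyc a b ++ cyc a b′ → Σ V λ y → Σ V λ x → l ≡ u ∷ v ∷ y ∷ x ∷ a ∷ []
    row-end {a} l∈ with ∈-++⁻ (cyc a b) l∈
    ... | inj₁ p = let x , eq , _ = ∈-cyc⁻ p in b , x , eq
    ... | inj₂ p = let x , eq , _ = ∈-cyc⁻ p in b′ , x , eq

    cycles-unique : Unique cycles
    cycles-unique = Unique.++⁺ (row-unique a) (row-unique a′) λ (p , q) → clash (row-end p) (row-end q)
      where
      clash : ∀ {l} → (Σ V λ y → Σ V λ x → l ≡ u ∷ v ∷ y ∷ x ∷ a ∷ []) →
              (Σ V λ y → Σ V λ x → l ≡ u ∷ v ∷ y ∷ x ∷ a′ ∷ []) → ⊥
      clash (_ , _ , refl) (_ , _ , refl) = N3.y≢z s refl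

    place : ∀ {c x d} → d ≡ v ⊎ d ≡ a ⊎ d ≡ a′ → c ≡ u ⊎ c ≡ b ⊎ c ≡ b′ → d ≢ v → c ≢ u →
            E d x → E x c → u ∷ v ∷ c ∷ x ∷ d ∷ [] ∈ cycles
    place (inj₁ p) _ d≢v _ = contradiction p d≢v
    place (inj₂ _) (inj₁ p) _ c≢u = contradiction p c≢u
    place (inj₂ (inj₁ refl)) (inj₂ (inj₁ refl)) _ _ p q = ∈-++⁺ˡ (∈-++⁺ˡ (∈-cyc⁺ p q))
    place (inj₂ (inj₁ refl)) (inj₂ (inj₂ refl)) _ _ p q = ∈-++⁺ˡ (∈-++⁺ʳ (cyc a b) (∈-cyc⁺ p q))
    place (inj₂ (inj₂ refl)) (inj₂ (inj₁ refl)) _ _ p q = ∈-++⁺ʳ (cyc a b ++ cyc a b′) (∈-++⁺ˡ (∈-cyc⁺ p q))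
    place (inj₂ (inj₂ refl)) (inj₂ (inj₂ refl)) _ _ p q = ∈-++⁺ʳ (cyc a b ++ cyc a b′) (∈-++⁺ʳ (cyc a′ b) (∈-cyc⁺ p q))

    ⊆-cycles : ∀ {l} → l ∈ lists Γ 5 → (isCycleᵇ Γ 5 l ∧ startsWithᵇ Γ u v l) ≡ true → l ∈ cycles
    ⊆-cycles {l} _ p with ∧-true⁻ {isCycleᵇ Γ 5 l} p
    ... | cycle , starts with isCycle⇒Pentagon l cycle
    ... | u′ , v′ , c , x , d , refl , P with ∧-true⁻ {⌊ u′ ≟ u ⌋} starts
    ... | pu , pv with ⌊⌋-true⁻ {i = u′} pu | ⌊⌋-true⁻ {i = v′} pv
    ... | refl | refl = place (N3.cover s (E-sym (Pentagon.ea P))) (N3.cover t (Pentagon.bc P))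
      (Pentagon.e≢b P) (Pentagon.a≢c P ∘ sym) (E-sym (Pentagon.de P)) (E-sym (Pentagon.cd P))

    cyc-⊆ : ∀ {a b l} → E u a → E v b → l ∈ cyc a b →
            l ∈ lists Γ 5 × (isCycleᵇ Γ 5 l ∧ startsWithᵇ Γ u v l) ≡ true
    cyc-⊆ {a} {b} ua vb l∈ with ∈-cyc⁻ l∈
    ... | x , refl , ax , xb = lists-complete _ ,
      ∧-true⁺ (Pentagon⇒isCycle (Pentagon-closed (N3.ex s) vb (E-sym xb) (E-sym ax) (E-sym ua)))
        (∧-true⁺ (⌊⌋-true⁺ {i = u} refl) (⌊⌋-true⁺ {i = v} refl))

    cycles-⊆ : ∀ {l} → l ∈ cycles → l ∈ lists Γ 5 × (isCycleᵇ Γ 5 l ∧ startsWithᵇ Γ u v l) ≡ true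
    cycles-⊆ l∈ with ∈-++⁻ (cyc a b ++ cyc a b′) l∈
    ... | inj₁ p with ∈-++⁻ (cyc a b) p
    ... | inj₁ q = cyc-⊆ (N3.ey s) (N3.ey t) q
    ... | inj₂ q = cyc-⊆ (N3.ey s) (N3.ez t) q
    cycles-⊆ l∈ | inj₂ p with ∈-++⁻ (cyc a′ b) p
    ... | inj₁ q = cyc-⊆ (N3.ez s) (N3.ey t) q
    ... | inj₂ q = cyc-⊆ (N3.ez s) (N3.ez t) q

  -- The four numbers `β` for a neighbour of `u` and a neighbour of `v` are summed by rows from one
  -- end of the edge and by columns from the other.
  ε-sym : ∀ {u v} → E u v → ε₅ u v ≡ ε₅ v u
  ε-sym {u} {v} uv with N3-with₁ uv | N3-with₁ (E-sym uv)
  ... | a , a′ , s | b , b′ , t = begin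
    ε₅ u v                                 ≡⟨ ε-C s ⟩
    C a u v + C a′ u v                     ≡⟨ cong₂ _+_ (C-β t) (C-β t) ⟩
    (β a b + β a b′) + (β a′ b + β a′ b′)  ≡⟨ interchange (β a b) _ _ _ ⟩
    (β a b + β a′ b) + (β a b′ + β a′ b′)  ≡⟨ cong₂ _+_ (cong₂ _+_ (flip (N3.ey s) (N3.ey t)) (flip (N3.ez s) (N3.ey t)))
                                                        (cong₂ _+_ (flip (N3.ey s) (N3.ez t)) (flip (N3.ez s) (N3.ez t))) ⟩
    (β b a + β b a′) + (β b′ a + β b′ a′)  ≡⟨ cong₂ _+_ (C-β s) (C-β s) ⟨
    C b v u + C b′ v u                     ≡⟨ ε-C t ⟨
    ε₅ v u                                 ∎
    where
    open ≡-Reasoning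
    interchange : ∀ p q r s → (p + q) + (r + s) ≡ (p + r) + (q + s)
    interchange = solve-∀
    flip : ∀ {a b} → E u a → E v b → β a b ≡ β b a
    flip ua vb = β-sym (path-ends (E-sym ua) uv vb)

-- Profiles: recovering the values of `C` from the signature

sort-≡ : ∀ {xs a b c} → xs ↭ (a ∷ b ∷ c ∷ []) → a ≤ b → b ≤ c → sort xs ≡ a ∷ b ∷ c ∷ []
sort-≡ {xs} p a≤b b≤c = Pointwise-≡⇒≡ (↗↭↗⇒≋ ≤-totalOrder (sort-↗ xs) (a≤b ∷ b≤c ∷ [-])
  (↭⇒↭ₛ (↭-trans (sort-↭ xs) p)))

-- Twice `a` is the sum of the first two pair sums minus the third.
pair-sums-injective : ∀ {a b c a′ b′ c′} → a + b ≡ a′ + b′ → a + c ≡ a′ + c′ → b + c ≡ b′ + c′ → a ≡ a′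
pair-sums-injective {a} {b} {c} {a′} {b′} {c′} p q r =
  *-cancelˡ-≡ a a′ 2 (+-cancelʳ-≡ (b + c) (2 * a) (2 * a′) (begin
    2 * a + (b + c)        ≡⟨ rearrange a b c ⟩
    (a + b) + (a + c)      ≡⟨ cong₂ _+_ p q ⟩
    (a′ + b′) + (a′ + c′)  ≡⟨ rearrange a′ b′ c′ ⟨
    2 * a′ + (b′ + c′)     ≡⟨ cong (2 * a′ +_) r ⟨
    2 * a′ + (b + c)       ∎))
  where
  open ≡-Reasoning
  rearrange : ∀ a b c → 2 * a + (b + c) ≡ (a + b) + (a + c)
  rearrange = solve-∀

module Profiles (Γ : Graph) (cubic : Cubic Γ) (girth : Girth Γ 5) where

  open CubicGirth₅ Γ cubic girth public

  -- Each of `X`, `Y`, `Z` is named after the neighbour that its path avoids. The edge to a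
  -- neighbour therefore has as its `ε₅` the sum of the two values with other names.
  record Profile (v : V) (X Y Z : ℕ) : Set where
    constructor profile
    field
      {x y z} : V
      nbrs : N3 v x y z
      Cyz  : C y v z ≡ X
      Cxz  : C x v z ≡ Y
      Cxy  : C x v y ≡ Z

    open N3 nbrs public

    Czy : C z v y ≡ X
    Czy = trans (C-sym (E-sym ez) ey) Cyz
    Czx : C z v x ≡ Y
    Czx = trans (C-sym (E-sym ez) ex) Cxz
    Cyx : C y v x ≡ Z
    Cyx = trans (C-sym (E-sym ey) ex) Cxy

    εz : ε₅ v z ≡ X + Y
    εz = trans (ε-C (N3-swap₁₂ (N3-rot nbrs))) (cong₂ _+_ Cyz Cxz)
    εy : ε₅ v y ≡ X + Z
    εy = trans (ε-C (N3-rot nbrs)) (cong₂ _+_ Czy Cxy)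
    εx : ε₅ v x ≡ Y + Z
    εx = trans (ε-C (N3-swap₂₃ nbrs)) (cong₂ _+_ Czx Cyx)

    -- The neighbours are taken in the order `z`, `y`, `x` because the pair sums are then increasing
    -- as soon as `X` ≤ `Y` ≤ `Z`.
    signature-↭ : map (ε Γ 5 v) (neighbours Γ v) ↭ (X + Y ∷ X + Z ∷ Y + Z ∷ [])
    signature-↭ = ↭-trans (map-↭ (ε Γ 5 v) (N3-↭ (N3-swap₁₂ (N3-rot nbrs))))
      (↭-reflexive (cong₂ _∷_ (trans (ε₅-def v z) εz) (cong₂ _∷_ (trans (ε₅-def v y) εy) (cong (_∷ []) (trans (ε₅-def v x) εx)))))

  Profile-swap₁₂ : ∀ {v X Y Z} → Profile v X Y Z → Profile v Y X Z
  Profile-swap₁₂ p = profile (N3-swap₁₂ nbrs) Cxz Cyz Cyx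
    where open Profile p

  Profile-swap₂₃ : ∀ {v X Y Z} → Profile v X Y Z → Profile v X Z Y
  Profile-swap₂₃ p = profile (N3-swap₂₃ nbrs) Czy Cxy Cxz
    where open Profile p

  record SortedProfile (v : V) : Set where
    constructor sorted
    field
      {X Y Z} : ℕ
      X≤Y : X ≤ Y
      Y≤Z : Y ≤ Z
      prof : Profile v X Y Z

    signature-≡ : signature Γ 5 v ≡ X + Y ∷ X + Z ∷ Y + Z ∷ []
    signature-≡ = sort-≡ (Profile.signature-↭ prof) (+-monoʳ-≤ X Y≤Z) (+-mono-≤ X≤Y ≤-refl)

  Profile-sort₂₃ : ∀ {v X Y Z} → X ≤ Y → Profile v X Y Z → SortedProfile v
  Profile-sort₂₃ {v} {X} {Y} {Z} X≤Y p with ≤-total Y Z | ≤-total X Z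
  ... | inj₁ Y≤Z | _        = sorted X≤Y Y≤Z p
  ... | inj₂ Z≤Y | inj₁ X≤Z = sorted X≤Z Z≤Y (Profile-swap₂₃ p)
  ... | inj₂ Z≤Y | inj₂ Z≤X = sorted Z≤X X≤Y (Profile-swap₁₂ (Profile-swap₂₃ p))

  Profile-sort : ∀ {v X Y Z} → Profile v X Y Z → SortedProfile v
  Profile-sort {v} {X} {Y} {Z} p with ≤-total X Y
  ... | inj₁ X≤Y = Profile-sort₂₃ X≤Y p
  ... | inj₂ Y≤X = Profile-sort₂₃ Y≤X (Profile-swap₁₂ p)

  sorted-profile : ∀ v → SortedProfile v
  sorted-profile v with N3-any v
  ... | x , y , z , t = Profile-sort (profile t refl refl refl)

  β≤1 : ∀ {a b} → a ≢ b → β a b ≤ 1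
  β≤1 {a} {b} a≢b with Good? a b
  ... | yes g = ≤-reflexive (β-yes g a≢b)
  ... | no ¬g = subst (_≤ 1) (sym (β-no ¬g)) z≤n

  C≤2 : ∀ {a u v} → E a u → E u v → C a u v ≤ 2
  C≤2 {a} {u} {v} au uv with N3-with₁ (E-sym uv)
  ... | b , b′ , t = subst (_≤ 2) (sym (C-β t))
    (+-mono-≤ (β≤1 (path-ends au uv (N3.ey t))) (β≤1 (path-ends au uv (N3.ez t))))

  -- Each of the two continuations contributes at most 1, so the maximal value is reached only if
  -- both close up.
  C≡2 : ∀ {a u v b} → C a u v ≡ 2 → E a u → E u v → E v b → u ≢ b → Good a b
  C≡2 {a} {u} {v} {b} C2 au uv vb u≢b with Good? a b
  ... | yes g = g
  ... | no ¬g with N3-with₂ (E-sym uv) vb u≢b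
  ... | b′ , t with subst (2 ≤_) (trans (sym C2) (trans (C-β t) (cong (_+ β a b′) (β-no ¬g)))) ≤-refl
  ... | 2≤β with ≤-trans 2≤β (β≤1 (path-ends au uv (N3.ez t)))
  ... | s≤s ()

  C≡1 : ∀ {a u v b b′} → C a u v ≡ 1 → E a u → N3 v u b b′ → ¬ Good a b → Good a b′
  C≡1 {a} {u} {v} {b} {b′} C1 au t ¬g with Good? a b′
  ... | yes g′ = g′
  ... | no ¬g′ with trans (sym C1) (trans (C-β t) (cong₂ _+_ (β-no ¬g) (β-no ¬g′)))
  ... | ()

  C≡1′ : ∀ {a u v b b′} → C a u v ≡ 1 → E a u → N3 v u b b′ → Good a b → ¬ Good a b′
  C≡1′ {a} {u} {v} {b} {b′} C1 au t g g′
    with trans (sym C1) (trans (C-β t) (cong₂ _+_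
      (β-yes g (path-ends au (E-sym (N3.ex t)) (N3.ey t)))
      (β-yes g′ (path-ends au (E-sym (N3.ex t)) (N3.ez t)))))
  ... | ()

  C≢0 : ∀ {a u v b} → E a u → E u v → E v b → u ≢ b → Good a b → C a u v ≢ 0
  C≢0 {a} {u} {v} {b} au uv vb u≢b g C0 with N3-with₂ (E-sym uv) vb u≢b
  ... | b′ , t with trans (sym C0) (trans (C-β t) (cong (_+ β a b′) (β-yes g (path-ends au uv vb))))
  ... | ()

  Pentagon⇒C≢0 : ∀ {a b c d e} → Pentagon a b c d e → C a b c ≢ 0
  Pentagon⇒C≢0 P = C≢0 P.ab P.bc P.cd P.b≢d (_ , E-sym P.ea , E-sym P.de)
    where module P = Pentagon P

  C-all-equal : ∀ {v k} → Profile v k k k → ∀ {a b} → E v a → E v b → a ≢ b → C a v b ≡ k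
  C-all-equal p ea eb a≢b with Profile.cover p ea | Profile.cover p eb
  ... | inj₁ refl        | inj₁ refl        = contradiction refl a≢b
  ... | inj₁ refl        | inj₂ (inj₁ refl) = Profile.Cxy p
  ... | inj₁ refl        | inj₂ (inj₂ refl) = Profile.Cxz p
  ... | inj₂ (inj₁ refl) | inj₁ refl        = Profile.Cyx p
  ... | inj₂ (inj₁ refl) | inj₂ (inj₁ refl) = contradiction refl a≢b
  ... | inj₂ (inj₁ refl) | inj₂ (inj₂ refl) = Profile.Cyz p
  ... | inj₂ (inj₂ refl) | inj₁ refl        = Profile.Czx p
  ... | inj₂ (inj₂ refl) | inj₂ (inj₁ refl) = Profile.Czy p
  ... | inj₂ (inj₂ refl) | inj₂ (inj₂ refl) = contradiction refl a≢b

  -- Sorting puts the pair sums in the same order at both vertices, so they can be compared entry by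
  -- entry and then inverted.
  SortedProfile-≡ : ∀ {u v X Y Z} (S : SortedProfile v) → X ≤ Y → Y ≤ Z → Profile u X Y Z →
    signature Γ 5 u ≡ signature Γ 5 v → Profile v X Y Z
  SortedProfile-≡ {u} {v} {X₀} {Y₀} {Z₀} S@(sorted {X} {Y} {Z} _ _ p) X≤Y Y≤Z p₀ sig =
    transport X≡ Y≡ Z≡ p
    where
    eq : X₀ + Y₀ ∷ X₀ + Z₀ ∷ Y₀ + Z₀ ∷ [] ≡ X + Y ∷ X + Z ∷ Y + Z ∷ []
    eq = trans (sym (SortedProfile.signature-≡ (sorted X≤Y Y≤Z p₀)))
      (trans sig (SortedProfile.signature-≡ S))
    s₁ : X₀ + Y₀ ≡ X + Y
    s₁ = proj₁ (∷-injective eq)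
    s₂ : X₀ + Z₀ ≡ X + Z
    s₂ = proj₁ (∷-injective (proj₂ (∷-injective eq)))
    s₃ : Y₀ + Z₀ ≡ Y + Z
    s₃ = proj₁ (∷-injective (proj₂ (∷-injective (proj₂ (∷-injective eq)))))
    comm : ∀ {a b c d} → a + b ≡ c + d → b + a ≡ d + c
    comm {a} {b} {c} {d} p = trans (+-comm b a) (trans p (+-comm c d))
    X≡ : X₀ ≡ X
    X≡ = pair-sums-injective s₁ s₂ s₃
    Y≡ : Y₀ ≡ Y
    Y≡ = pair-sums-injective (comm {X₀} {Y₀} {X} {Y} s₁) s₃ s₂
    Z≡ : Z₀ ≡ Z
    Z≡ = pair-sums-injective {Z₀} {X₀} {Y₀} {Z} {X} {Y} (comm {X₀} {Z₀} {X} {Z} s₂) (comm {Y₀} {Z₀} {Y} {Z} s₃) s₁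
    transport : ∀ {X Y Z X₀ Y₀ Z₀} → X₀ ≡ X → Y₀ ≡ Y → Z₀ ≡ Z → Profile v X Y Z → Profile v X₀ Y₀ Z₀
    transport refl refl refl p = p

  common-profile : (∀ u v → signature Γ 5 u ≡ signature Γ 5 v) →
    Σ ℕ λ X → Σ ℕ λ Y → Σ ℕ λ Z → X ≤ Y × Y ≤ Z × Z ≤ 2 × (∀ v → Profile v X Y Z)
  common-profile sig = from (sorted-profile v₀)
    where
    v₀ : V
    v₀ = proj₁ some-pentagon
    from : SortedProfile v₀ →
      Σ ℕ λ X → Σ ℕ λ Y → Σ ℕ λ Z → X ≤ Y × Y ≤ Z × Z ≤ 2 × (∀ v → Profile v X Y Z)
    from (sorted X≤Y Y≤Z p) = _ , _ , _ , X≤Y , Y≤Z ,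
      subst (_≤ 2) (Profile.Cxy p) (C≤2 (E-sym (Profile.ex p)) (Profile.ey p)) ,
      λ v → SortedProfile-≡ (sorted-profile v) X≤Y Y≤Z p (sig v₀ v)

  -- Triples with a distinguished edge at each vertex

  -- A perfect matching μ whose edges are recognised by their value K of ε₅;
  -- A counts the pentagons through the two unmatched edges at a vertex.
  record Matching (A : ℕ) : Set where
    field
      K   : ℕ
      μ p q : V → V
      nbr : ∀ v → N3 v (μ v) (p v) (q v)
      εμ  : ∀ v → ε₅ v (μ v) ≡ K
      εp  : ∀ v → ε₅ v (p v) ≢ K
      εq  : ∀ v → ε₅ v (q v) ≢ K
      Cpq : ∀ v → C (p v) v (q v) ≡ A

    Eμ : ∀ {v} → E v (μ v)
    Eμ {v} = N3.ex (nbr v)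

    μ-unique : ∀ {v w} → E v w → ε₅ v w ≡ K → w ≡ μ v
    μ-unique {v} e εK with N3.cover (nbr v) e
    ... | inj₁ w≡          = w≡
    ... | inj₂ (inj₁ refl) = contradiction εK (εp v)
    ... | inj₂ (inj₂ refl) = contradiction εK (εq v)

    -- By `ε-sym` the edge has value `K` from `μ v` as well, and only one edge at `μ v` has this
    -- value.
    μμ : ∀ v → μ (μ v) ≡ v
    μμ v = sym (μ-unique (E-sym Eμ) (trans (ε-sym (E-sym Eμ)) (εμ v)))

    μ-flip : ∀ {v w} → w ≡ μ v → v ≡ μ w
    μ-flip refl = sym (μμ _)

    μ-injective : ∀ {v w} → μ v ≡ μ w → v ≡ w
    μ-injective {v} {w} eq = trans (sym (μμ v)) (trans (cong μ eq) (μμ w))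

    infix 4 _~_
    _~_ : V → V → Set
    v ~ w = E v w × w ≢ μ v

    ~-sym : ∀ {v w} → v ~ w → w ~ v
    ~-sym (e , ne) = E-sym e , ne ∘ μ-flip

    ~-cases : ∀ {v w} → v ~ w → w ≡ p v ⊎ w ≡ q v
    ~-cases {v} (e , ne) with N3.cover (nbr v) e
    ... | inj₁ w≡ = contradiction w≡ ne
    ... | inj₂ c  = c

    ~p : ∀ {v} → v ~ p v
    ~p {v} = N3.ey (nbr v) , N3.x≢y (nbr v) ∘ sym

    ~q : ∀ {v} → v ~ q v
    ~q {v} = N3.ez (nbr v) , N3.x≢z (nbr v) ∘ sym

    p≢q : ∀ {v} → p v ≢ q v
    p≢q {v} = N3.y≢z (nbr v)

    -- In this and later names `n` stands for an unmatched and `M` for a matched edge, in the order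
    -- of the path.
    Cnn : ∀ {x v y} → x ~ v → v ~ y → x ≢ y → C x v y ≡ A
    Cnn {x} {v} {y} xv vy x≢y with ~-cases (~-sym xv) | ~-cases vy
    ... | inj₁ refl | inj₁ refl = contradiction refl x≢y
    ... | inj₁ refl | inj₂ refl = Cpq v
    ... | inj₂ refl | inj₁ refl = trans (C-sym (proj₁ xv) (proj₁ vy)) (Cpq v)
    ... | inj₂ refl | inj₂ refl = contradiction refl x≢y

    ~-next : ∀ {u v} → u ~ v → ∃ λ w → v ~ w × u ≢ w
    ~-next {u} {v} (uv , u≁) with N3-with₂ (E-sym uv) (Eμ {v}) (u≁ ∘ μ-flip)
    ... | w , t = w , (N3.ez t , N3.y≢z t ∘ sym) , N3.x≢z t

    N3-~ : ∀ {u v w} → v ~ u → v ~ w → u ≢ w → N3 v u (μ v) w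
    N3-~ vu vw u≢w = N3-with₃ (proj₁ vu) Eμ (proj₁ vw) (proj₂ vu) u≢w (proj₂ vw ∘ sym)

    Mixed : ℕ → Set
    Mixed B = ∀ v → C (μ v) v (p v) ≡ B × C (μ v) v (q v) ≡ B

    CMn : ∀ {B} → Mixed B → ∀ {v w} → v ~ w → C (μ v) v w ≡ B
    CMn mixed {v} vw with ~-cases vw
    ... | inj₁ refl = proj₁ (mixed v)
    ... | inj₂ refl = proj₂ (mixed v)

  -- Matched and unmatched edges would alternate around a cycle of odd length.
  no-Matching-0 : Matching 0 → ⊥
  no-Matching-0 M = let _ , _ , _ , _ , _ , P = some-pentagon in main P
    where
    open Matching M
    -- No pentagon passes a vertex along both of its unmatched edges, since their count is 0.
    alternate : ∀ {a b c d e} → Pentagon a b c d e → a ≡ μ b ⊎ c ≡ μ b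
    alternate {a} {b} {c} P with a ≟ μ b | c ≟ μ b
    ... | yes r | _     = inj₁ r
    ... | no _  | yes r = inj₂ r
    ... | no r  | no s  = contradiction
      (Cnn (~-sym (E-sym (Pentagon.ab P) , r)) (Pentagon.bc P , s) (Pentagon.a≢c P)) (Pentagon⇒C≢0 P)

    -- With `a` and `b` matched to each other, `c` and `e` would both have to be matched to `d`.
    matched-first : ∀ {a b c d e} → Pentagon a b c d e → a ≡ μ b → ⊥
    matched-first {a} {b} {c} {d} {e} P a≡μb = step₁ (alternate P₃)
      where
      P₁ = Pentagon-rot P
      P₂ = Pentagon-rot P₁
      P₃ = Pentagon-rot P₂
      step₂ : d ≡ μ e → b ≡ μ c ⊎ d ≡ μ c → ⊥
      step₂ d≡μe (inj₁ b≡μc) = Pentagon.a≢c P (trans a≡μb (sym (μ-flip b≡μc)))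
      step₂ d≡μe (inj₂ d≡μc) = Pentagon.c≢e P (μ-injective (trans (sym d≡μc) d≡μe))
      step₁ : d ≡ μ e ⊎ a ≡ μ e → ⊥
      step₁ (inj₁ d≡μe) = step₂ d≡μe (alternate P₁)
      step₁ (inj₂ a≡μe) = Pentagon.e≢b P (μ-injective (trans (sym a≡μe) a≡μb))

    main : ∀ {a b c d e} → Pentagon a b c d e → ⊥
    main P with alternate P
    ... | inj₁ r = matched-first P r
    ... | inj₂ r = matched-first (Pentagon-rot P) (μ-flip r)

  -- Since both continuations of `p v`, `v`, `q v` close up, so does the one along the matched edge
  -- at `q v`. Its pentagon contains the path `v`, `q v`, `μ (q v)`, whose count is 0.
  no-Matching-2-0 : (M : Matching 2) → Matching.Mixed M 0 → ⊥
  no-Matching-2-0 M mixed = C≢0 (E-sym Eμ) (proj₁ (~-sym ~q)) (proj₁ ~p) (p≢q ∘ sym) (Good-sym good)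
      (CMn mixed (~-sym ~q))
    where
    open Matching M
    v : V
    v = proj₁ some-pentagon
    good : Good (p v) (μ (q v))
    good = C≡2 (Cpq v) (proj₁ (~-sym ~p)) (proj₁ ~q) Eμ (proj₂ (~-sym ~q))

  -- At most one edge of a pentagon is matched, so it contains four consecutive
  -- unmatched edges; but both pentagons through the middle two of these use a matched edge.
  no-Matching-2-1 : (M : Matching 2) → Matching.Mixed M 1 → ⊥
  no-Matching-2-1 M mixed = let _ , _ , _ , _ , _ , P = some-pentagon in main P
    where
    open Matching M
    -- Let `u′` be the other unmatched neighbour of `u`. The count 2 of `u′`, `u`, `v` closes the
    -- path from `u′` to `μ v`, and this uses up the single pentagon through `μ v`, `v`, `u`.
    ¬good-MnM : ∀ {u v} → u ~ v → ¬ Good (μ u) (μ v)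
    ¬good-MnM {u} {v} uv g with ~-next (~-sym uv)
    ... | u′ , uu′ , v≢u′ = C≡1′ (CMn mixed (~-sym uv)) (E-sym Eμ)
      (N3-~ uv uu′ v≢u′) (Good-sym g)
      (Good-sym (C≡2 (Cnn (~-sym uu′) uv (v≢u′ ∘ sym)) (E-sym (proj₁ uu′)) (proj₁ uv) Eμ (proj₂ (~-sym uv))))

    ¬nnnn : ∀ {a u v w b} → Pentagon a u v w b → a ~ u → u ~ v → v ~ w → w ~ b → ⊥
    ¬nnnn {a} {u} {v} {w} {b} P au uv vw wb
      with C≡2 (Cnn uv vw (Pentagon.b≢d P)) (proj₁ uv) (proj₁ vw) Eμ (proj₂ (~-sym vw))
    ... | y , uy , yμ with N3.cover (N3-~ uv (~-sym au) (Pentagon.a≢c P ∘ sym)) uy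
    ... | inj₁ refl = no-triangle yμ (E-sym Eμ) (E-sym (proj₁ vw))
    ... | inj₂ (inj₂ refl) = no-square yμ (E-sym Eμ) (proj₁ wb) (Pentagon.ea P)
      (Pentagon.d≢a P ∘ sym) (proj₂ wb ∘ sym)
    -- Here the unmatched edge from `μ u` to `μ w` lies between two matched edges of a pentagon
    -- whose fifth vertex is `v`.
    ... | inj₂ (inj₁ refl) = ¬good-MnM {μ u} {μ w}
      (yμ , λ eq → no-triangle (proj₁ uv) (proj₁ vw) (subst (E w) (trans eq (μμ u)) Eμ))
      (v , subst (λ z → E z v) (sym (μμ u)) (proj₁ uv) , subst (E v) (sym (μμ w)) (proj₁ vw))

    matched-first : ∀ {a b c d e} → Pentagon a b c d e → b ≡ μ a → ⊥
    matched-first {a} {b} {c} {d} {e} P b≡μa = go (d ≟ μ c) (e ≟ μ d)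
      where
      open Pentagon P
      b~c : b ~ c
      b~c = bc , λ c≡μb → a≢c (trans (μ-flip b≡μa) (sym c≡μb))
      e~a : e ~ a
      e~a = ea , λ a≡μe → e≢b (trans (μ-flip a≡μe) (sym b≡μa))
      go : Dec (d ≡ μ c) → Dec (e ≡ μ d) → ⊥
      go (yes d≡μc) _ = ¬good-MnM b~c (e , subst (λ z → E z e) (μ-flip b≡μa) (E-sym ea) , subst (E e) d≡μc (E-sym de))
      go _ (yes e≡μd) = ¬good-MnM e~a (c , subst (λ z → E z c) (μ-flip e≡μd) (E-sym cd) , subst (E c) b≡μa (E-sym bc))
      go (no d≢μc) (no e≢μd) = ¬nnnn (Pentagon-rot P) b~c (cd , d≢μc) (de , e≢μd) e~a

    main : ∀ {a b c d e} → Pentagon a b c d e → ⊥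
    main {a} {b} {c} {d} {e} P with b ≟ μ a | c ≟ μ b | d ≟ μ c | e ≟ μ d
    ... | yes r | _ | _ | _ = matched-first P r
    ... | no _ | yes r | _ | _ = matched-first (Pentagon-rot P) r
    ... | no _ | no _ | yes r | _ = matched-first (Pentagon-rot (Pentagon-rot P)) r
    ... | no _ | no _ | no _ | yes r = matched-first (Pentagon-rot (Pentagon-rot (Pentagon-rot P))) r
    ... | no r₁ | no r₂ | no r₃ | no r₄ = ¬nnnn P
      (Pentagon.ab P , r₁) (Pentagon.bc P , r₂) (Pentagon.cd P , r₃) (Pentagon.de P , r₄)

  -- Along an unmatched path a, b, c, d, e, f the partners of vertices at distance 2 are
  -- adjacent; this leaves no common neighbour for μ c and μ d, which should have one.
  no-Matching-1-2 : (M : Matching 1) → Matching.Mixed M 2 → ⊥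
  no-Matching-1-2 M mixed = main
    where
    open Matching M
    -- Both continuations of `μ v`, `v`, `u` close up, so the single pentagon through `t`, `u`, `v`
    -- leaves `v` along the matched edge and not towards `w`.
    ¬good-nnn : ∀ {t u v w} → t ~ u → u ~ v → v ~ w → t ≢ v → u ≢ w → ¬ Good t w
    ¬good-nnn {t} {u} {v} {w} tu uv vw t≢v u≢w = C≡1′ (Cnn tu uv t≢v) (proj₁ tu)
      (N3-~ (~-sym uv) vw u≢w)
      (Good-sym (C≡2 (CMn mixed (~-sym uv)) (E-sym Eμ) (proj₁ (~-sym uv)) (proj₁ (~-sym tu)) (t≢v ∘ sym)))

    -- The count 2 of `μ c`, `c`, `d` gives a common neighbour of `μ c` and `e`. Of the neighbours
    -- of `e`, `d` yields a triangle and `f` closes the unmatched path `c`, `d`, `e`, `f`; `μ e` is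
    -- left.
    partners : ∀ {c d e} → c ~ d → d ~ e → c ≢ e → E (μ c) (μ e)
    partners {c} {d} {e} cd de c≢e
      with ~-next de | C≡2 (CMn mixed cd) (E-sym Eμ) (proj₁ cd) (proj₁ de) c≢e
    ... | f , ef , d≢f | x , μx , xe with N3.cover (N3-~ (~-sym de) ef d≢f) (E-sym xe)
    ... | inj₁ refl = ⊥-elim (no-triangle μx (E-sym (proj₁ cd)) Eμ)
    ... | inj₂ (inj₁ refl) = μx
    ... | inj₂ (inj₂ refl) = contradiction (μ c , Eμ , μx) (¬good-nnn cd de ef c≢e d≢f)

    second-partners : ∀ {a b c d e} → a ~ b → b ~ c → c ~ d → d ~ e → a ≢ c → b ≢ d → c ≢ e →
                      N3 (μ c) c (μ a) (μ e)
    second-partners ab bc cd de a≢c b≢d c≢e = N3-with₃ (E-sym Eμ)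
      (partners (~-sym bc) (~-sym ab) (a≢c ∘ sym)) (partners cd de c≢e)
      (λ { refl → no-triangle (proj₁ ab) (proj₁ bc) (E-sym Eμ) })
      (λ { refl → no-triangle (proj₁ cd) (proj₁ de) Eμ })
      (λ eq → case (μ-injective eq))
      where
      case : _ ≡ _ → ⊥
      case refl = no-square (proj₁ ab) (proj₁ bc) (proj₁ cd) (proj₁ de) a≢c b≢d

    no-path : ∀ {a b c d e f} → a ~ b → b ~ c → c ~ d → d ~ e → e ~ f →
              a ≢ c → b ≢ d → c ≢ e → d ≢ f → ⊥
    no-path {a} {b} {c} {d} {e} {f} ab bc cd de ef a≢c b≢d c≢e d≢f
      with C≡2 (CMn mixed cd) (E-sym Eμ) (proj₁ cd) Eμ (proj₂ (~-sym cd))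
    ... | x , cx , xd = case (N3.cover (second-partners ab bc cd de a≢c b≢d c≢e) cx)
                             (N3.cover (second-partners bc cd de ef b≢d c≢e d≢f) (E-sym xd))
      where
      case : x ≡ c ⊎ x ≡ μ a ⊎ x ≡ μ e → x ≡ d ⊎ x ≡ μ b ⊎ x ≡ μ f → ⊥
      case (inj₁ refl) _ = no-triangle (proj₁ cd) Eμ (E-sym xd)
      case (inj₂ _) (inj₁ refl) = no-triangle (proj₁ cd) (E-sym cx) (E-sym Eμ)
      case (inj₂ (inj₁ r)) (inj₂ (inj₁ s)) = E-irr (proj₁ ab) (μ-injective (trans (sym r) s))
      -- Here `a` = `f`, which would close the unmatched path `b`, `c`, `d`, `e`.
      case (inj₂ (inj₁ r)) (inj₂ (inj₂ s)) = ¬good-nnn bc cd de b≢d c≢e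
        (a , proj₁ (~-sym ab) , subst (λ z → E z e) (sym (μ-injective (trans (sym r) s))) (proj₁ (~-sym ef)))
      case (inj₂ (inj₂ r)) (inj₂ (inj₁ s)) = no-triangle (proj₁ cd) (proj₁ de)
        (subst (λ z → E z c) (sym (μ-injective (trans (sym r) s))) (proj₁ bc))
      case (inj₂ (inj₂ r)) (inj₂ (inj₂ s)) = E-irr (proj₁ ef) (μ-injective (trans (sym r) s))

    main : ⊥
    main with ~-next (~-sym (~q {proj₁ some-pentagon})) | ~-next (~q {proj₁ some-pentagon})
    ... | b , cb , q≢b | e , de , c≢e with ~-next cb | ~-next de
    ... | a , ba , c≢a | f , ef , d≢f = no-path (~-sym ba) (~-sym cb) ~q de ef (c≢a ∘ sym) (q≢b ∘ sym) c≢e d≢f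

-- Finite models given by neighbour tables, and covers by them

allᵇ : ∀ {m} → (Fin m → Bool) → Bool
allᵇ {zero}  P = true
allᵇ {suc m} P = P zero ∧ allᵇ (P ∘ suc)

allᵇ-sound : ∀ {m} (P : Fin m → Bool) → allᵇ P ≡ true → ∀ i → P i ≡ true
allᵇ-sound {suc m} P eq zero    = proj₁ (∧-true⁻ {P zero} eq)
allᵇ-sound {suc m} P eq (suc i) = allᵇ-sound (P ∘ suc) (proj₂ (∧-true⁻ {P zero} eq)) i

-- Row i lists the three neighbours of vertex i.
Table : ℕ → Set
Table m = Vec (Fin m × Fin m × Fin m) m

module _ {m} (t : Table m) where

  t₁ t₂ t₃ : Fin m → Fin m
  t₁ i = proj₁ (lookup t i)
  t₂ i = proj₁ (proj₂ (lookup t i))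
  t₃ i = proj₂ (proj₂ (lookup t i))

  tableAdj : Fin m → Fin m → Bool
  tableAdj i j = ⌊ j ≟ t₁ i ⌋ ∨ ⌊ j ≟ t₂ i ⌋ ∨ ⌊ j ≟ t₃ i ⌋

  tableAdj⁻ : ∀ {i j} → tableAdj i j ≡ true → j ≡ t₁ i ⊎ j ≡ t₂ i ⊎ j ≡ t₃ i
  tableAdj⁻ {i} {j} p with ∨-true⁻ {⌊ j ≟ t₁ i ⌋} p
  ... | inj₁ q = inj₁ (⌊⌋-true⁻ q)
  ... | inj₂ q with ∨-true⁻ {⌊ j ≟ t₂ i ⌋} q
  ... | inj₁ r = inj₂ (inj₁ (⌊⌋-true⁻ r))
  ... | inj₂ r = inj₂ (inj₂ (⌊⌋-true⁻ r))

  tableAdj⁺ : ∀ {i j} → j ≡ t₁ i ⊎ j ≡ t₂ i ⊎ j ≡ t₃ i → tableAdj i j ≡ true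
  tableAdj⁺ {i} {j} c with j ≟ t₁ i | j ≟ t₂ i | j ≟ t₃ i
  ... | yes _ | _     | _     = refl
  ... | no _  | yes _ | _     = refl
  ... | no _  | no _  | yes _ = refl
  ... | no q₁ | no q₂ | no q₃ with c
  ... | inj₁ q        = contradiction q q₁
  ... | inj₂ (inj₁ q) = contradiction q q₂
  ... | inj₂ (inj₂ q) = contradiction q q₃

  agreesᵇ : (Fin m → Fin m → Bool) → Bool
  agreesᵇ H = allᵇ λ i → allᵇ λ j → ⌊ H i j Data.Bool.≟ tableAdj i j ⌋

  agrees-sound : (H : Fin m → Fin m → Bool) → agreesᵇ H ≡ true → ∀ i j → H i j ≡ tableAdj i j
  agrees-sound H p i j with H i j Data.Bool.≟ tableAdj i j
    | allᵇ-sound (λ j → ⌊ H i j Data.Bool.≟ tableAdj i j ⌋) (allᵇ-sound _ p i) j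
  ... | yes q | _ = q

module Covers (Γ : Graph) (conn : Connected Γ) (cubic : Cubic Γ) (girth : Girth Γ 5) where

  open Profiles Γ cubic girth

  -- A covering map: each star of the table goes bijectively to a star of `Γ`. Connectedness makes
  -- it surjective; injectivity is supplied separately to `iso`.
  record Cover {m} (t : Table m) : Set where
    field
      φ    : Fin m → V
      star : ∀ i → N3 (φ i) (φ (t₁ t i)) (φ (t₂ t i)) (φ (t₃ t i))

    edge : ∀ {i j} → tableAdj t i j ≡ true → E (φ i) (φ j)
    edge {i} {j} p with tableAdj⁻ t {i} {j} p
    ... | inj₁ refl        = N3.ex (star i)
    ... | inj₂ (inj₁ refl) = N3.ey (star i)
    ... | inj₂ (inj₂ refl) = N3.ez (star i)

    lift : ∀ {i w} → E (φ i) w → ∃ λ j → tableAdj t i j ≡ true × w ≡ φ j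
    lift {i} e with N3.cover (star i) e
    ... | inj₁ q        = t₁ t i , tableAdj⁺ t {i} (inj₁ refl) , q
    ... | inj₂ (inj₁ q) = t₂ t i , tableAdj⁺ t {i} (inj₂ (inj₁ refl)) , q
    ... | inj₂ (inj₂ q) = t₃ t i , tableAdj⁺ t {i} (inj₂ (inj₂ refl)) , q

    locally-injective : ∀ {k i j} → tableAdj t k i ≡ true → tableAdj t k j ≡ true → i ≢ j → φ i ≢ φ j
    locally-injective {k} {i} {j} p q i≢j with tableAdj⁻ t {k} {i} p | tableAdj⁻ t {k} {j} q
    ... | inj₁ refl        | inj₁ refl        = contradiction refl i≢j
    ... | inj₁ refl        | inj₂ (inj₁ refl) = N3.x≢y (star k)
    ... | inj₁ refl        | inj₂ (inj₂ refl) = N3.x≢z (star k)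
    ... | inj₂ (inj₁ refl) | inj₁ refl        = N3.x≢y (star k) ∘ sym
    ... | inj₂ (inj₁ refl) | inj₂ (inj₁ refl) = contradiction refl i≢j
    ... | inj₂ (inj₁ refl) | inj₂ (inj₂ refl) = N3.y≢z (star k)
    ... | inj₂ (inj₂ refl) | inj₁ refl        = N3.x≢z (star k) ∘ sym
    ... | inj₂ (inj₂ refl) | inj₂ (inj₁ refl) = N3.y≢z (star k) ∘ sym
    ... | inj₂ (inj₂ refl) | inj₂ (inj₂ refl) = contradiction refl i≢j

    -- A walk in `Γ` is lifted edge by edge.
    surjective : ∀ {i v} → Star E (φ i) v → ∃ λ j → φ j ≡ v
    surjective {i} ε⋆ = i , refl
    surjective (e ◅ es) with lift e
    ... | j , _ , refl = surjective es

    iso : (H : Fin m → Fin m → Bool) → agreesᵇ t H ≡ true → Fin m →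
          (∀ {i j} → i ≢ j → φ i ≢ φ j) → IsoTo Γ (Fin m) H
    iso H ok i₀ separated = mk↔ₛ′ ψ φ ψφ φψ , preserves
      where
      pre : ∀ v → ∃ λ j → φ j ≡ v
      pre v = surjective (conn (φ i₀) v)
      ψ : V → Fin m
      ψ v = proj₁ (pre v)
      φψ : ∀ v → φ (ψ v) ≡ v
      φψ v = proj₂ (pre v)
      injective : ∀ {i j} → φ i ≡ φ j → i ≡ j
      injective {i} {j} eq with i ≟ j
      ... | yes q = q
      ... | no q  = contradiction eq (separated q)
      ψφ : ∀ i → ψ (φ i) ≡ i
      ψφ i = injective (φψ (φ i))
      H≡ : ∀ i j → adj (φ i) (φ j) ≡ H i j
      H≡ i j = trans (≡-from-⇔ back edge) (sym (agrees-sound t H ok i j))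
        where
        back : E (φ i) (φ j) → tableAdj t i j ≡ true
        back e with lift e
        ... | k , p , q with injective q
        ... | refl = p
      preserves : ∀ u v → adj u v ≡ H (ψ u) (ψ v)
      preserves u v = trans (sym (cong₂ adj (φψ u) (φψ v))) (H≡ (ψ u) (ψ v))

-- The two models and the separation of their vertices

infixl 8 _⁺ _⁻

-- Successor modulo 5, spelled out by cases: at concrete indices it evaluates, so the stars found
-- below match the rows of the tables.
_⁺ : Fin 5 → Fin 5
zero                     ⁺ = # 1
suc zero                 ⁺ = # 2
suc (suc zero)           ⁺ = # 3
suc (suc (suc zero))     ⁺ = # 4
suc (suc (suc (suc i)))  ⁺ = # 0

_⁻ : Fin 5 → Fin 5
zero                     ⁻ = # 4
suc zero                 ⁻ = # 0
suc (suc zero)           ⁻ = # 1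
suc (suc (suc zero))     ⁻ = # 2
suc (suc (suc (suc i)))  ⁻ = # 3

module _ {P : Fin 5 → Set} where

  five : P (# 0) → P (# 1) → P (# 2) → P (# 3) → P (# 4) → ∀ i → P i
  five a b c d e zero = a
  five a b c d e (suc zero) = b
  five a b c d e (suc (suc zero)) = c
  five a b c d e (suc (suc (suc zero))) = d
  five a b c d e (suc (suc (suc (suc zero)))) = e

⁺⁻ : ∀ i → i ⁺ ⁻ ≡ i
⁺⁻ = five refl refl refl refl refl

⁻⁺ : ∀ i → i ⁻ ⁺ ≡ i
⁻⁺ = five refl refl refl refl refl

⁺⁺⁺ : ∀ i → i ⁺ ⁺ ⁺ ≡ i ⁻ ⁻
⁺⁺⁺ = five refl refl refl refl refl

infixr 5 _∷ᶠ_
_∷ᶠ_ : ∀ {m} {P : Fin (suc m) → Set} → P zero → (∀ i → P (suc i)) → ∀ i → P i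
(x ∷ᶠ xs) zero    = x
(x ∷ᶠ xs) (suc i) = xs i

-- Rows are ordered like the stars `Np` and `Nq`: previous, next, spoke on the outer pentagon;
-- spoke, two steps forward, two steps back on the inner one.
petersenTable : Table 10
petersenTable =
  (# 4 , # 1 , # 5) ∷ (# 0 , # 2 , # 6) ∷ (# 1 , # 3 , # 7) ∷ (# 2 , # 4 , # 8) ∷ (# 3 , # 0 , # 9) ∷
  (# 0 , # 7 , # 8) ∷ (# 1 , # 8 , # 9) ∷ (# 2 , # 9 , # 5) ∷ (# 3 , # 5 , # 6) ∷ (# 4 , # 6 , # 7) ∷ []

-- Vertices 2i, 2i + 1, 10 + 2i, 11 + 2i are q i, r i, p i, s i below.
dodecahedronTable : Table 20
dodecahedronTable =
  (# 10 , # 9 , # 1) ∷ (# 0 , # 2 , # 11) ∷ (# 12 , # 1 , # 3) ∷ (# 2 , # 4 , # 13) ∷ (# 14 , # 3 , # 5) ∷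
  (# 4 , # 6 , # 15) ∷ (# 16 , # 5 , # 7) ∷ (# 6 , # 8 , # 17) ∷ (# 18 , # 7 , # 9) ∷ (# 8 , # 0 , # 19) ∷
  (# 18 , # 12 , # 0) ∷ (# 1 , # 19 , # 13) ∷ (# 10 , # 14 , # 2) ∷ (# 3 , # 11 , # 15) ∷ (# 12 , # 16 , # 4) ∷
  (# 5 , # 13 , # 17) ∷ (# 14 , # 18 , # 6) ∷ (# 7 , # 15 , # 19) ∷ (# 16 , # 10 , # 8) ∷ (# 9 , # 17 , # 11) ∷ []

and-sound : ∀ bs → and bs ≡ true → All (_≡ true) bs
and-sound []       _ = []
and-sound (b ∷ bs) p = let q , qs = ∧-true⁻ {b} p in q ∷ and-sound bs qs

any-sound : {A : Set} (P : A → Bool) (xs : List A) → any P xs ≡ true → ∃ λ x → P x ≡ true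
any-sound P (x ∷ xs) p with ∨-true⁻ {P x} p
... | inj₁ q = x , q
... | inj₂ q = any-sound P xs q

module _ {m} (t : Table m) where

  -- Certificates, given by the inner vertices of a walk from i to j (followed, for walks of
  -- length 5, by two vertices completing its second and third edges to a pentagon), that a
  -- cover does not identify i and j.  The flag tells whether each path of length 2 lies on a
  -- unique pentagon.
  separation : Bool → Fin m → Fin m → List (Fin m) → List Bool
  separation unique i j []               = tableAdj t i j ∷ []
  separation unique i j (k ∷ [])         = tableAdj t k i ∷ tableAdj t k j ∷ []
  separation unique i j (k ∷ l ∷ [])     = tableAdj t i k ∷ tableAdj t k l ∷ tableAdj t l j ∷ []
  separation unique i j (k ∷ l ∷ n ∷ []) =
    tableAdj t k i ∷ tableAdj t k l ∷ tableAdj t l k ∷ tableAdj t l n ∷ tableAdj t n j ∷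
    not ⌊ i ≟ l ⌋ ∷ not ⌊ k ≟ n ⌋ ∷ []
  separation unique i j (k ∷ l ∷ n ∷ o ∷ f ∷ g ∷ []) =
    unique ∷
    tableAdj t k i ∷ tableAdj t l k ∷ tableAdj t l n ∷ tableAdj t n l ∷ tableAdj t n o ∷ tableAdj t o j ∷
    tableAdj t n f ∷ tableAdj t f g ∷ tableAdj t g k ∷
    not ⌊ k ≟ n ⌋ ∷ not ⌊ l ≟ f ⌋ ∷ not ⌊ l ≟ o ⌋ ∷ not ⌊ f ≟ o ⌋ ∷ []
  separation unique i j _ = false ∷ []

  candidates : Fin m → Fin m → List (List (Fin m))
  candidates i j = [] ∷
    extend (next i) λ k → (k ∷ []) ∷
    extend (next k) λ l → (k ∷ l ∷ []) ∷
    extend (next l) λ n → (k ∷ l ∷ n ∷ []) ∷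
    extend (next j) λ o → extend (next n) λ f → extend (next k) λ g → (k ∷ l ∷ n ∷ o ∷ f ∷ g ∷ []) ∷ []
    where
    next : Fin m → List (Fin m)
    next i = t₁ t i ∷ t₂ t i ∷ t₃ t i ∷ []
    extend : List (Fin m) → (Fin m → List (List (Fin m))) → List (List (Fin m))
    extend xs f = concatMap f xs

  searchᵇ : Bool → Fin m → Fin m → Bool
  searchᵇ unique i j = any (and ∘ separation unique i j) (candidates i j)

  all-separatedᵇ : Bool → Bool
  all-separatedᵇ unique = allᵇ λ i → allᵇ λ j → ⌊ i ≟ j ⌋ ∨ searchᵇ unique i j

  all-separated : ∀ unique → all-separatedᵇ unique ≡ true →
                  ∀ {i j} → i ≢ j → ∃ λ w → All (_≡ true) (separation unique i j w)
  all-separated unique ok {i} {j} i≢j = found (∨-true⁻ {⌊ i ≟ j ⌋}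
      (allᵇ-sound (λ j → ⌊ i ≟ j ⌋ ∨ searchᵇ unique i j)
        (allᵇ-sound (λ i → allᵇ λ j → ⌊ i ≟ j ⌋ ∨ searchᵇ unique i j) ok i) j))
    where
    found : ⌊ i ≟ j ⌋ ≡ true ⊎ searchᵇ unique i j ≡ true →
            ∃ λ w → All (_≡ true) (separation unique i j w)
    found (inj₁ q) = contradiction (⌊⌋-true⁻ q) i≢j
    found (inj₂ q) = let w , c = any-sound (and ∘ separation unique i j) (candidates i j) q
                     in w , and-sound (separation unique i j w) c

module Separation (Γ : Graph) (conn : Connected Γ) (cubic : Cubic Γ) (girth : Girth Γ 5) where

  open Profiles Γ cubic girth
  open Covers Γ conn cubic girth

  module _ {m} {t : Table m} (F : Cover t) (unique : Bool)
           (one : unique ≡ true → ∀ {a u v} → E a u → E u v → a ≢ v → C a u v ≡ 1) where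

    open Cover F

    -- Identifying the ends of the walk would produce a loop, a repeated neighbour in a star, a
    -- triangle or a 4-cycle. For length 5 it would put the path `k`, `l`, `n` on a second pentagon,
    -- through `o` besides the one through `f` and `g`.
    separates : ∀ {i j} → i ≢ j → ∀ w → All (_≡ true) (separation t unique i j w) → φ i ≢ φ j
    separates _ [] (ij ∷ []) = E-irr (edge ij)
    separates i≢j (k ∷ []) (ki ∷ kj ∷ []) = locally-injective {k} ki kj i≢j
    separates _ (k ∷ l ∷ []) (ik ∷ kl ∷ lj ∷ []) eq =
      no-triangle (edge ik) (edge kl) (subst (E (φ l)) (sym eq) (edge lj))
    separates _ (k ∷ l ∷ n ∷ []) (ki ∷ kl ∷ lk ∷ ln ∷ nj ∷ i≢l ∷ k≢n ∷ []) eq =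
      no-square (E-sym (edge ki)) (edge kl) (edge ln) (subst (E (φ n)) (sym eq) (edge nj))
        (locally-injective {k} ki kl (not⌊⌋-true⁻ i≢l)) (locally-injective {l} lk ln (not⌊⌋-true⁻ k≢n))
    separates {i} _ (k ∷ l ∷ n ∷ o ∷ f ∷ g ∷ [])
      (un ∷ ki ∷ lk ∷ ln ∷ nl ∷ n-o ∷ oj ∷ nf ∷ fg ∷ gk ∷ k≢n ∷ l≢f ∷ l≢o ∷ f≢o ∷ []) eq =
      C≡1′ (one un (E-sym (edge lk)) (edge ln) (locally-injective {l} lk ln (not⌊⌋-true⁻ k≢n)))
        (E-sym (edge lk))
        (N3-with₃ (edge nl) (edge nf) (edge n-o)
          (locally-injective {n} nl nf (not⌊⌋-true⁻ l≢f))
          (locally-injective {n} nl n-o (not⌊⌋-true⁻ l≢o))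
          (locally-injective {n} nf n-o (not⌊⌋-true⁻ f≢o)))
        (φ g , E-sym (edge gk) , E-sym (edge fg))
        (φ i , edge ki , subst (λ z → E z (φ o)) (sym eq) (E-sym (edge oj)))
    separates _ (_ ∷ _ ∷ _ ∷ _ ∷ []) (() ∷ _)
    separates _ (_ ∷ _ ∷ _ ∷ _ ∷ _ ∷ []) (() ∷ _)
    separates _ (_ ∷ _ ∷ _ ∷ _ ∷ _ ∷ _ ∷ _ ∷ _) (() ∷ _)

    cover-iso : (H : Fin m → Fin m → Bool) → agreesᵇ t H ≡ true → all-separatedᵇ t unique ≡ true →
                Fin m → IsoTo Γ (Fin m) H
    cover-iso H ok sep i₀ = iso H ok i₀ λ {i} {j} i≢j →
      let w , c = all-separated t unique sep i≢j in separates i≢j w c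

  -- Covers built outwards from a pentagon

  record Rim : Set where
    field
      p  : Fin 5 → V
      q  : Fin 5 → V
      Np : ∀ i → N3 (p i) (p (i ⁻)) (p (i ⁺)) (q i)

    Ep : ∀ i → E (p i) (p (i ⁺))
    Ep i = N3.ey (Np i)
    Epq : ∀ i → E (p i) (q i)
    Epq i = N3.ez (Np i)
    Np⁺ : ∀ i → N3 (p (i ⁺)) (p i) (p (i ⁺ ⁺)) (q (i ⁺))
    Np⁺ i = subst (λ j → N3 (p (i ⁺)) (p j) (p (i ⁺ ⁺)) (q (i ⁺))) (⁺⁻ i) (Np (i ⁺))

    Ep⁻ : ∀ i → E (p (i ⁻)) (p i)
    Ep⁻ i = E-sym (N3.ex (Np i))
    Ep³ : ∀ i → E (p (i ⁺ ⁺ ⁺)) (p (i ⁻))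
    Ep³ i = subst₂ (λ j k → E (p j) (p k)) (sym (⁺⁺⁺ i)) (⁻⁺ (i ⁻)) (Ep (i ⁻ ⁻))
    p³≢p : ∀ i → p (i ⁺ ⁺ ⁺) ≢ p i
    p³≢p i = subst₂ (λ j k → p j ≢ p k) (sym (⁺⁺⁺ i)) (⁻⁺ i) (N3.x≢y (Np (i ⁻)))
    q⁺≢q : ∀ i → q (i ⁺) ≢ q i
    q⁺≢q i eq = no-triangle (Ep i) (Epq (i ⁺)) (subst (λ z → E z (p i)) (sym eq) (E-sym (Epq i)))

  some-rim : Rim
  some-rim = let _ , _ , _ , _ , _ , P = some-pentagon in from P
    where
    from : ∀ {a b c d e} → Pentagon a b c d e → Rim
    from {a} {b} {c} {d} {e} P = record { p = p ; q = λ i → proj₁ (third i) ; Np = λ i → proj₂ (third i) }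
      where
      open Pentagon P
      p : Fin 5 → V
      p = five a b c d e
      third : ∀ i → ∃ λ q → N3 (p i) (p (i ⁻)) (p (i ⁺)) q
      third = five (N3-with₂ (E-sym ea) ab e≢b) (N3-with₂ (E-sym ab) bc a≢c) (N3-with₂ (E-sym bc) cd b≢d)
        (N3-with₂ (E-sym cd) de c≢e) (N3-with₂ (E-sym de) ea d≢a)

  module Petersen (two : ∀ {a u v} → E a u → E u v → a ≢ v → C a u v ≡ 2) (R : Rim) where

    open Rim R

    -- The path `q i`, `p i`, `p (i ⁺)`, `p (i ⁺ ⁺)` closes up. The closing vertex is a neighbour of
    -- `p (i ⁺ ⁺)`, and those on the rim would create a triangle or a 4-cycle.
    Eq : ∀ i → E (q i) (q (i ⁺ ⁺))
    Eq i with C≡2 (two (E-sym (Epq i)) (Ep i) (N3.y≢z (Np i) ∘ sym)) (E-sym (Epq i)) (Ep i) (Ep (i ⁺))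
                  (N3.x≢y (Np⁺ i))
    ... | x , qx , xp with N3.cover (Np⁺ (i ⁺)) (E-sym xp)
    ... | inj₁ refl = ⊥-elim (no-triangle qx (E-sym (Ep i)) (Epq i))
    ... | inj₂ (inj₂ refl) = qx
    ... | inj₂ (inj₁ refl) = ⊥-elim (no-square qx (Ep³ i) (Ep⁻ i) (Epq i) (N3.x≢z (Np i) ∘ sym) (p³≢p i))

    Nq : ∀ i → N3 (q i) (p i) (q (i ⁺ ⁺)) (q (i ⁻ ⁻))
    Nq i = N3-with₃ (E-sym (Epq i)) (Eq i)
      (E-sym (subst (λ j → E (q (i ⁻ ⁻)) (q j)) (trans (cong _⁺ (⁻⁺ (i ⁻))) (⁻⁺ i)) (Eq (i ⁻ ⁻))))
      (λ eq → no-triangle (Ep i) (Ep (i ⁺)) (subst (E (p (i ⁺ ⁺))) (sym eq) (Epq (i ⁺ ⁺))))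
      (λ eq → no-triangle (Ep⁻ (i ⁻)) (Ep⁻ i) (E-sym (subst (E (p (i ⁻ ⁻))) (sym eq) (Epq (i ⁻ ⁻)))))
      (λ eq → q⁺≢q (i ⁺ ⁺) (trans (cong q (⁺⁺⁺ i)) (sym eq)))

    cover : Cover petersenTable
    cover = record { φ = φ ; star = star }
      where
      φ : Fin 10 → V
      φ = lookup (p (# 0) ∷ p (# 1) ∷ p (# 2) ∷ p (# 3) ∷ p (# 4) ∷
                  q (# 0) ∷ q (# 1) ∷ q (# 2) ∷ q (# 3) ∷ q (# 4) ∷ [])
      star : ∀ i → N3 (φ i) (φ (t₁ petersenTable i)) (φ (t₂ petersenTable i)) (φ (t₃ petersenTable i))
      star = Np (# 0) ∷ᶠ Np (# 1) ∷ᶠ Np (# 2) ∷ᶠ Np (# 3) ∷ᶠ Np (# 4) ∷ᶠ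
              Nq (# 0) ∷ᶠ Nq (# 1) ∷ᶠ Nq (# 2) ∷ᶠ Nq (# 3) ∷ᶠ Nq (# 4) ∷ᶠ λ ()

  petersen : (∀ {a u v} → E a u → E u v → a ≢ v → C a u v ≡ 2) → IsoTo Γ (Fin 10) petersenAdj
  -- The two `refl` evaluate the comparison with `petersenAdj` and the search for certificates.
  -- Vertices of the model are at distance at most 2, so the flag can be `false`.
  petersen two = cover-iso (Petersen.cover two some-rim) false (λ ()) petersenAdj refl refl zero

  -- Around the pentagon `p`, the vertices `q` are its outer neighbours, `r` completes the pentagons
  -- across its edges, and `s` forms the opposite pentagon. The alternating 10-cycle of `q` and `r`
  -- is the outer cycle of the generalised Petersen graph.
  module Dodecahedron (one : ∀ {a u v} → E a u → E u v → a ≢ v → C a u v ≡ 1) where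

    module Ring₁ (R : Rim) where

      open Rim R

      -- The rim is the only pentagon through `p i`, `p (i ⁺)`, `p (i ⁺ ⁺)`, so the pentagon through
      -- `q i`, `p i`, `p (i ⁺)` must leave the rim at `p (i ⁺)`.
      good-qq : ∀ i → Good (q i) (q (i ⁺))
      good-qq i = C≡1 (one (E-sym (Epq i)) (Ep i) (N3.y≢z (Np i) ∘ sym)) (E-sym (Epq i)) (Np⁺ i)
        λ g → C≡1′ (one (E-sym (Ep (i ⁺))) (E-sym (Ep i)) (N3.x≢y (Np⁺ i) ∘ sym)) (E-sym (Ep (i ⁺)))
          (N3-swap₁₂ (Np i)) (p (i ⁺ ⁺ ⁺) , Ep (i ⁺ ⁺) , Ep³ i) (Good-sym g)

    module Ring₂ (R : Rim) (r : Fin 5 → V)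
                 (Eqr : ∀ i → E (Rim.q R i) (r i)) (Erq : ∀ i → E (r i) (Rim.q R (i ⁺))) where

      open Rim R

      Erq⁻ : ∀ i → E (r (i ⁻)) (q i)
      Erq⁻ i = subst (λ j → E (r (i ⁻)) (q j)) (⁻⁺ i) (Erq (i ⁻))

      p≢r : ∀ i → p i ≢ r i
      p≢r i eq = no-triangle (Ep i) (Epq (i ⁺)) (E-sym (subst (λ z → E z (q (i ⁺))) (sym eq) (Erq i)))

      Nq : ∀ i → N3 (q i) (p i) (r (i ⁻)) (r i)
      Nq i = N3-with₃ (E-sym (Epq i)) (E-sym (Erq⁻ i)) (Eqr i)
        (λ eq → no-triangle (Ep⁻ i) (E-sym (subst (E (q (i ⁻))) (sym eq) (Eqr (i ⁻)))) (E-sym (Epq (i ⁻))))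
        (p≢r i)
        -- If `r (i ⁻)` and `r i` coincided, the path `r i`, `q i`, `p i` would close up on both
        -- sides.
        (λ eq → C≡1′ (one (E-sym (Eqr i)) (E-sym (Epq i)) (p≢r i ∘ sym)) (E-sym (Eqr i))
          (N3-rot (N3-rot (Np i)))
          (q (i ⁻) , subst (λ z → E z (q (i ⁻))) eq (E-sym (Eqr (i ⁻))) , E-sym (Epq (i ⁻)))
          (q (i ⁺) , Erq i , E-sym (Epq (i ⁺))))

      Nq⁺ : ∀ i → N3 (q (i ⁺)) (p (i ⁺)) (r i) (r (i ⁺))
      Nq⁺ i = subst (λ j → N3 (q (i ⁺)) (p (i ⁺)) (r j) (r (i ⁺))) (⁺⁻ i) (Nq (i ⁺))

      third : ∀ i → ∃ λ s → N3 (r i) (q i) (q (i ⁺)) s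
      third i = N3-with₂ (E-sym (Eqr i)) (Erq i) (q⁺≢q i ∘ sym)

      module Ring₃ (s : Fin 5 → V) (Nr : ∀ i → N3 (r i) (q i) (q (i ⁺)) (s i)) where

        Ers : ∀ i → E (r i) (s i)
        Ers i = N3.ez (Nr i)

        -- The path `q (i ⁺ ⁺)`, `r (i ⁺)`, `q (i ⁺)` already lies on the pentagon across the rim
        -- edge from `p (i ⁺)` to `p (i ⁺ ⁺)`.
        ¬good-rq : ∀ i → ¬ Good (r i) (q (i ⁺ ⁺))
        ¬good-rq i g = C≡1′ (one (E-sym (Erq (i ⁺))) (E-sym (Eqr (i ⁺))) (q⁺≢q (i ⁺))) (E-sym (Erq (i ⁺)))
          (N3-rot (N3-rot (Nq⁺ i))) (p (i ⁺ ⁺) , E-sym (Epq (i ⁺ ⁺)) , E-sym (Ep (i ⁺))) (Good-sym g)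

        ¬E-qs : ∀ i → ¬ E (q i) (s (i ⁺))
        ¬E-qs i e = C≡1′ (one (Eqr i) (Erq i) (q⁺≢q i ∘ sym)) (Eqr i) (N3-swap₁₂ (Nq⁺ i))
          (p i , E-sym (Epq i) , Ep i) (s (i ⁺) , e , E-sym (Ers (i ⁺)))

        -- The pentagon through `r i`, `q (i ⁺)`, `r (i ⁺)` cannot continue to `q (i ⁺ ⁺)`, so it
        -- continues to `s (i ⁺)`; among the neighbours of `r i` only `s i` can close it.
        Es : ∀ i → E (s i) (s (i ⁺))
        Es i = let x , rx , xs = C≡1 (one (Erq i) (Eqr (i ⁺)) (N3.y≢z (Nq⁺ i))) (Erq i) (Nr (i ⁺)) (¬good-rq i)
               in which xs (N3.cover (Nr i) rx)
          where
          which : ∀ {x} → E x (s (i ⁺)) → x ≡ q i ⊎ x ≡ q (i ⁺) ⊎ x ≡ s i → E (s i) (s (i ⁺))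
          which xs (inj₁ refl)        = contradiction xs (¬E-qs i)
          which xs (inj₂ (inj₁ refl)) = ⊥-elim (no-triangle xs (E-sym (Ers (i ⁺))) (E-sym (Eqr (i ⁺))))
          which xs (inj₂ (inj₂ refl)) = xs

        r≢s⁺ : ∀ i → r i ≢ s (i ⁺)
        r≢s⁺ i eq = no-triangle (Erq i) (Eqr (i ⁺)) (subst (E (r (i ⁺))) (sym eq) (Ers (i ⁺)))

        Ns : ∀ i → N3 (s i) (r i) (s (i ⁻)) (s (i ⁺))
        Ns i = N3-with₃ (E-sym (Ers i)) (E-sym (subst (λ j → E (s (i ⁻)) (s j)) (⁻⁺ i) (Es (i ⁻)))) (Es i)
          (λ eq → no-triangle (E-sym (Eqr i)) (E-sym (Erq⁻ i)) (subst (E (r (i ⁻))) (sym eq) (Ers (i ⁻))))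
          (r≢s⁺ i)
          (λ eq → C≡1′ (one (E-sym (Es i)) (E-sym (Ers i)) (r≢s⁺ i ∘ sym)) (E-sym (Es i))
            (N3-rot (N3-rot (Nr i)))
            (r (i ⁻) , subst (λ z → E z (r (i ⁻))) eq (E-sym (Ers (i ⁻))) , Erq⁻ i)
            (r (i ⁺) , E-sym (Ers (i ⁺)) , E-sym (Eqr (i ⁺))))

        cover : Cover dodecahedronTable
        cover = record { φ = φ ; star = star }
          where
          φ : Fin 20 → V
          φ = lookup (q (# 0) ∷ r (# 0) ∷ q (# 1) ∷ r (# 1) ∷ q (# 2) ∷ r (# 2) ∷ q (# 3) ∷ r (# 3) ∷ q (# 4) ∷ r (# 4) ∷
                      p (# 0) ∷ s (# 0) ∷ p (# 1) ∷ s (# 1) ∷ p (# 2) ∷ s (# 2) ∷ p (# 3) ∷ s (# 3) ∷ p (# 4) ∷ s (# 4) ∷ [])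
          star : ∀ i → N3 (φ i) (φ (t₁ dodecahedronTable i)) (φ (t₂ dodecahedronTable i)) (φ (t₃ dodecahedronTable i))
          star =
            Nq (# 0) ∷ᶠ Nr (# 0) ∷ᶠ Nq (# 1) ∷ᶠ Nr (# 1) ∷ᶠ Nq (# 2) ∷ᶠ Nr (# 2) ∷ᶠ Nq (# 3) ∷ᶠ Nr (# 3) ∷ᶠ Nq (# 4) ∷ᶠ Nr (# 4) ∷ᶠ
            Np (# 0) ∷ᶠ Ns (# 0) ∷ᶠ Np (# 1) ∷ᶠ Ns (# 1) ∷ᶠ Np (# 2) ∷ᶠ Ns (# 2) ∷ᶠ Np (# 3) ∷ᶠ Ns (# 3) ∷ᶠ Np (# 4) ∷ᶠ Ns (# 4) ∷ᶠ λ ()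

    cover : Cover dodecahedronTable
    cover = Ring₃.cover (λ i → proj₁ (third i)) (λ i → proj₂ (third i))
      where
      open Ring₁ some-rim
      open Ring₂ some-rim (λ i → proj₁ (good-qq i))
        (λ i → proj₁ (proj₂ (good-qq i))) (λ i → proj₂ (proj₂ (good-qq i)))

  dodecahedron : (∀ {a u v} → E a u → E u v → a ≢ v → C a u v ≡ 1) → IsoTo Γ (Fin 20) dodecahedronAdj
  dodecahedron one = cover-iso (Dodecahedron.cover one) true (λ _ → one) dodecahedronAdj refl refl zero

-- Quotients and pairings of finite sets

record Quotient {n} (R : Fin n → Fin n → Set) : Set where
  field
    classes  : ℕ
    cls      : Fin n → Fin classes
    rep      : Fin classes → Fin n
    cls-rep  : ∀ c → cls (rep c) ≡ c
    sound    : ∀ {i j} → R i j → cls i ≡ cls j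
    complete : ∀ {i j} → cls i ≡ cls j → R i j

-- By induction, the element `zero` joins the class of a later element related to it, or else opens
-- a new class.
quotient : ∀ {n} (R : Fin n → Fin n → Set) → (∀ i j → Dec (R i j)) → (∀ {i} → R i i) →
           (∀ {i j} → R i j → R j i) → (∀ {i j k} → R i j → R j k → R i k) → Quotient R
quotient {zero} R R? r s t = record
  { classes = 0 ; cls = λ () ; rep = λ () ; cls-rep = λ ()
  ; sound = λ { {()} } ; complete = λ { {()} } }
quotient {suc n} R R? r s t
  with quotient (λ i j → R (suc i) (suc j)) (λ i j → R? (suc i) (suc j)) r s t | any? (λ j → R? zero (suc j))
... | Q | yes (j , zj) = record
  { classes = classes ; cls = cls′ ; rep = suc ∘ rep ; cls-rep = cls-rep ; sound = sound′ ; complete = complete′ }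
  where
  open Quotient Q
  cls′ : Fin (suc n) → Fin classes
  cls′ zero    = cls j
  cls′ (suc i) = cls i
  sound′ : ∀ {i k} → R i k → cls′ i ≡ cls′ k
  sound′ {zero}  {zero}  e = refl
  sound′ {zero}  {suc k} e = sound (t (s zj) e)
  sound′ {suc i} {zero}  e = sound (t e zj)
  sound′ {suc i} {suc k} e = sound e
  complete′ : ∀ {i k} → cls′ i ≡ cls′ k → R i k
  complete′ {zero}  {zero}  e = r
  complete′ {zero}  {suc k} e = t zj (complete e)
  complete′ {suc i} {zero}  e = t (complete e) (s zj)
  complete′ {suc i} {suc k} e = complete e
... | Q | no ¬zj = record
  { classes = suc classes ; cls = cls′ ; rep = rep′ ; cls-rep = cls-rep′ ; sound = sound′ ; complete = complete′ }
  where
  open Quotient Q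
  cls′ : Fin (suc n) → Fin (suc classes)
  cls′ zero    = zero
  cls′ (suc i) = suc (cls i)
  rep′ : Fin (suc classes) → Fin (suc n)
  rep′ zero    = zero
  rep′ (suc c) = suc (rep c)
  cls-rep′ : ∀ c → cls′ (rep′ c) ≡ c
  cls-rep′ zero    = refl
  cls-rep′ (suc c) = cong suc (cls-rep c)
  sound′ : ∀ {i k} → R i k → cls′ i ≡ cls′ k
  sound′ {zero}  {zero}  e = refl
  sound′ {zero}  {suc k} e = contradiction (k , e) ¬zj
  sound′ {suc i} {zero}  e = contradiction (i , s e) ¬zj
  sound′ {suc i} {suc k} e = cong suc (sound e)
  complete′ : ∀ {i k} → cls′ i ≡ cls′ k → R i k
  complete′ {zero}  {zero}  e = r
  complete′ {suc i} {suc k} e = complete (suc-injective e)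

-- The orbits of a fixed-point-free involution are unordered pairs; the Boolean orders them.
pairing : ∀ {n} (μ : Fin n → Fin n) → (∀ v → μ (μ v) ≡ v) → (∀ v → v ≢ μ v) →
  ∃ λ k → Σ (Fin n ↔ (Fin k × Bool)) λ f →
    ∀ v → Inverse.to f (μ v) ≡ (proj₁ (Inverse.to f v) , not (proj₂ (Inverse.to f v)))
pairing {n} μ μμ fixfree = classes , mk↔ₛ′ to from to-from from-to ,
    λ v → cong₂ _,_ (sound (inj₂ (sym (μμ v)))) (side-μ v)
  where
  Orbit : Fin n → Fin n → Set
  Orbit v w = v ≡ w ⊎ w ≡ μ v
  orbit-sym : ∀ {v w} → Orbit v w → Orbit w v
  orbit-sym (inj₁ refl) = inj₁ refl
  orbit-sym (inj₂ refl) = inj₂ (sym (μμ _))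
  orbit-trans : ∀ {u v w} → Orbit u v → Orbit v w → Orbit u w
  orbit-trans (inj₁ refl) o           = o
  orbit-trans (inj₂ refl) (inj₁ refl) = inj₂ refl
  orbit-trans (inj₂ refl) (inj₂ refl) = inj₁ (sym (μμ _))
  open Quotient (quotient Orbit (λ v w → (v ≟ w) ⊎-dec (w ≟ μ v)) (inj₁ refl) orbit-sym orbit-trans)

  side : Fin n → Bool
  side v = ⌊ v <? μ v ⌋

  side-μ : ∀ v → side (μ v) ≡ not (side v)
  side-μ v with v <? μ v | μ v <? μ (μ v) | Fin.<-cmp v (μ v)
  ... | yes _ | no _  | _           = refl
  ... | no _  | yes _ | _           = refl
  ... | yes p | yes q | tri< _ _ ¬q = contradiction (subst (λ w → μ v Data.Fin.< w) (μμ v) q) ¬q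
  ... | yes p | _     | tri> ¬p _ _ = contradiction p ¬p
  ... | no ¬p | _     | tri< p _ _  = contradiction p ¬p
  ... | no _  | no ¬q | tri> _ _ q  = contradiction (subst (λ w → μ v Data.Fin.< w) (sym (μμ v)) q) ¬q
  ... | _     | _     | tri≈ _ eq _ = contradiction eq (fixfree v)

  to : Fin n → Fin classes × Bool
  to v = cls v , side v

  select : (u : Fin n) (b : Bool) → Dec (side u ≡ b) → Fin n
  select u b (yes _) = u
  select u b (no _)  = μ u

  from : Fin classes × Bool → Fin n
  from (c , b) = select (rep c) b (side (rep c) Data.Bool.≟ b)

  to-from : ∀ a → to (from a) ≡ a
  to-from (c , b) with side (rep c) Data.Bool.≟ b
  ... | yes p = cong₂ _,_ (cls-rep c) p
  ... | no ¬p = cong₂ _,_ (trans (sound (inj₂ (sym (μμ (rep c))))) (cls-rep c))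
    (trans (side-μ (rep c)) (sym (¬-not (¬p ∘ sym))))

  from-to : ∀ v → from (to v) ≡ v
  from-to v with side (rep (cls v)) Data.Bool.≟ side v | complete (cls-rep (cls v))
  ... | yes p | inj₁ eq = eq
  ... | yes p | inj₂ eq = contradiction (trans (cong side eq) (side-μ (rep (cls v)))) (not-¬ (sym p))
  ... | no ¬p | inj₁ eq = contradiction (cong side eq) ¬p
  ... | no ¬p | inj₂ eq = sym eq

-- The triple (0,0,1): contracting the pentagons

allArcs-unique : (Λ : Multigraph) → Unique (allArcs Λ)
allArcs-unique Λ = subst Unique (sym (concatMap-map _,_ (allFin (Multigraph.nE Λ)) (false ∷ true ∷ [])))
  (Unique.cartesianProductWith⁺ _,_ (λ { refl → refl , refl }) (Unique.allFin⁺ _) (((λ ()) ∷ []) ∷ [] ∷ []))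

allArcs-complete : (Λ : Multigraph) (a : Arc Λ) → a ∈ allArcs Λ
allArcs-complete Λ (e , b) = subst ((e , b) ∈_) (sym (concatMap-map _,_ (allFin (Multigraph.nE Λ)) (false ∷ true ∷ [])))
  (∈-cartesianProductWith⁺ _,_ (∈-allFin e) (both b))
  where
  both : ∀ b → b ∈ (false ∷ true ∷ [])
  both false = here refl
  both true  = there (here refl)

-- The pentagons partition the vertices; Λ has them as vertices and the matched edges as edges.
module Truncation (Γ : Graph) (cubic : Cubic Γ) (girth : Girth Γ 5) where

  open Profiles Γ cubic girth

  module _ (M : Matching 1) (mixed : Matching.Mixed M 0) where

    open Matching M

    -- A matched edge of a pentagon would be followed by an unmatched one, and such a path has count
    -- 0.
    Pentagon⇒~ : ∀ {a b c d e} → Pentagon a b c d e → b ~ c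
    Pentagon⇒~ P = P.bc , λ { refl → Pentagon⇒C≢0 P
      (trans (C-sym P.ab P.bc) (CMn mixed (E-sym P.ab , P.a≢c))) }
      where module P = Pentagon P

    record Face (v : V) : Set where
      constructor face
      field
        {a b c d} : V
        pent : Pentagon v a b c d

      open Pentagon pent public renaming
        (ab to va; bc to ab; cd to bc; de to cd; ea to dv; a≢c to v≢b; b≢d to a≢c; c≢e to b≢d; d≢a to c≢v; e≢b to d≢a)

      members : List V
      members = v ∷ a ∷ b ∷ c ∷ d ∷ []

      v~a : v ~ a
      v~a = Pentagon⇒~ (Pentagon-rot (Pentagon-rot (Pentagon-rot (Pentagon-rot pent))))
      a~b : a ~ b
      a~b = Pentagon⇒~ pent
      b~c : b ~ c
      b~c = Pentagon⇒~ (Pentagon-rot pent)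
      c~d : c ~ d
      c~d = Pentagon⇒~ (Pentagon-rot (Pentagon-rot pent))
      d~v : d ~ v
      d~v = Pentagon⇒~ (Pentagon-rot (Pentagon-rot (Pentagon-rot pent)))

      members-unique : Unique members
      members-unique = (E-irr va ∷ v≢b ∷ (c≢v ∘ sym) ∷ (E-irr dv ∘ sym) ∷ []) ∷
        (E-irr ab ∷ a≢c ∷ (d≢a ∘ sym) ∷ []) ∷ (E-irr bc ∷ b≢d ∷ []) ∷ (E-irr cd ∷ []) ∷ [] ∷ []

      two : ∀ {x y z w} → x ~ y → y ~ z → x ≢ z → y ~ w → w ≡ x ⊎ w ≡ z
      two xy yz x≢z yw with N3.cover (N3-~ (~-sym xy) yz x≢z) (proj₁ yw)
      ... | inj₁ eq        = inj₁ eq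
      ... | inj₂ (inj₁ eq) = contradiction eq (proj₂ yw)
      ... | inj₂ (inj₂ eq) = inj₂ eq

      -- Both unmatched edges of each member are sides of the pentagon, which is thus a whole
      -- component of `~`.
      closed : ∀ {x y} → x ∈ members → x ~ y → y ∈ members
      closed (here refl) xy with two d~v v~a d≢a xy
      ... | inj₁ refl = there (there (there (there (here refl))))
      ... | inj₂ refl = there (here refl)
      closed (there (here refl)) xy with two v~a a~b v≢b xy
      ... | inj₁ refl = here refl
      ... | inj₂ refl = there (there (here refl))
      closed (there (there (here refl))) xy with two a~b b~c a≢c xy
      ... | inj₁ refl = there (here refl)
      ... | inj₂ refl = there (there (there (here refl)))
      closed (there (there (there (here refl)))) xy with two b~c c~d b≢d xy
      ... | inj₁ refl = there (there (here refl))
      ... | inj₂ refl = there (there (there (there (here refl))))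
      closed (there (there (there (there (here refl))))) xy with two c~d d~v c≢v xy
      ... | inj₁ refl = there (there (there (here refl)))
      ... | inj₂ refl = here refl

      reachable⇒∈ : ∀ {x y} → x ∈ members → Star _~_ x y → y ∈ members
      reachable⇒∈ x∈ ε⋆       = x∈
      reachable⇒∈ x∈ (e ◅ es) = reachable⇒∈ (closed x∈ e) es

      ∈⇒reachable : ∀ {w} → w ∈ members → Star _~_ v w
      ∈⇒reachable (here refl) = ε⋆
      ∈⇒reachable (there (here refl)) = v~a ◅ ε⋆
      ∈⇒reachable (there (there (here refl))) = v~a ◅ a~b ◅ ε⋆
      ∈⇒reachable (there (there (there (here refl)))) = v~a ◅ a~b ◅ b~c ◅ ε⋆
      ∈⇒reachable (there (there (there (there (here refl))))) = ~-sym d~v ◅ ε⋆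

    -- One continuation of `p v`, `v`, `q v` closes up. It is not the one along the matched edge at
    -- `q v`, as the path `v`, `q v`, `μ (q v)` has count 0.
    face-of : ∀ v → Face v
    face-of v with ~-next (~q {v})
    ... | w , qw , v≢w with C≡1 (Cpq v) (proj₁ (~-sym ~p)) (N3-~ (~-sym ~q) qw v≢w)
      (λ g → C≢0 (E-sym Eμ) (proj₁ (~-sym ~q)) (proj₁ ~p) (p≢q ∘ sym) (Good-sym g) (CMn mixed (~-sym ~q)))
    ... | x , px , xw = face (Pentagon-closed (proj₁ ~q) (proj₁ qw) (E-sym xw) (E-sym px) (proj₁ (~-sym ~p)))

    SameFace : V → V → Set
    SameFace = Star _~_

    same-face? : ∀ v w → Dec (SameFace v w)
    same-face? v w = map′ (Face.∈⇒reachable F) (Face.reachable⇒∈ F (here refl))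
      (dec-∈? _≟_ w (Face.members F))
      where
      F : Face v
      F = face-of v

    faces : Quotient SameFace
    faces = quotient SameFace same-face? ε⋆ (reverse ~-sym) _◅◅_

    module _ (F : Quotient SameFace) (k : ℕ) (f : V ↔ (Fin k × Bool))
             (f-μ : ∀ v → Inverse.to f (μ v) ≡ (proj₁ (Inverse.to f v) , not (proj₂ (Inverse.to f v)))) where

      open Quotient F
      open Inverse f using (to; from; strictlyInverseˡ; strictlyInverseʳ)

      -- Arcs correspond to vertices of `Γ` by `f`, inversion to `μ`, and the tail of an arc is the
      -- pentagon containing its vertex.
      Λ : Multigraph
      Λ = record { nV = classes ; nE = k ; ends = λ e → cls (from (e , false)) , cls (from (e , true)) }

      tail-cls : ∀ a → tail Λ a ≡ cls (from a)
      tail-cls (e , false) = refl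
      tail-cls (e , true)  = refl

      to-injective : ∀ {u v} → to u ≡ to v → u ≡ v
      to-injective {u} {v} eq = trans (sym (strictlyInverseʳ u)) (trans (cong from eq) (strictlyInverseʳ v))

      from-inv : ∀ a → from (inv Λ a) ≡ μ (from a)
      from-inv a = trans (cong from (trans (cong (inv Λ) (sym (strictlyInverseˡ a))) (sym (f-μ (from a)))))
        (strictlyInverseʳ (μ (from a)))

      -- This is `~` carried over to arcs, where being matched means being inverse.
      rel : Arc Λ → Arc Λ → Bool
      rel a b = adj (from a) (from b) ∧ not ⌊ _≟A_ Λ (inv Λ a) b ⌋

      rel⇒~ : ∀ {a b} → rel a b ≡ true → from a ~ from b
      rel⇒~ {a} {b} r with ∧-true⁻ {adj (from a) (from b)} r
      ... | e , ne = e , λ eq → dec-no⁻ (_≟A_ Λ (inv Λ a) b) ne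
        (trans (sym (strictlyInverseˡ (inv Λ a))) (trans (cong to (trans (from-inv a) (sym eq))) (strictlyInverseˡ b)))

      ~⇒rel : ∀ {a b} → from a ~ from b → rel a b ≡ true
      ~⇒rel {a} {b} (e , ne) = ∧-true⁺ e (dec-no (_≟A_ Λ (inv Λ a) b)
        λ eq → ne (trans (cong from (sym eq)) (from-inv a)))

      ~⇒rel-to : ∀ {u v} → u ~ v → rel (to u) (to v) ≡ true
      ~⇒rel-to {u} {v} e = ~⇒rel (subst₂ _~_ (sym (strictlyInverseʳ u)) (sym (strictlyInverseʳ v)) e)

      two-regular : ∀ a → length (filterᵇ (rel a) (allArcs Λ)) ≡ 2
      two-regular a = ↭-length (filterᵇ-↭ (rel a) {ys = to (p (from a)) ∷ to (q (from a)) ∷ []} (allArcs-unique Λ)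
          ((p≢q ∘ to-injective ∷ []) ∷ [] ∷ [])
          (λ {b} _ r → listed b (~-cases (rel⇒~ r)))
          (λ { (here refl)         → allArcs-complete Λ _ , back ~p
             ; (there (here refl)) → allArcs-complete Λ _ , back ~q }))
        where
        listed : ∀ b → from b ≡ p (from a) ⊎ from b ≡ q (from a) → b ∈ (to (p (from a)) ∷ to (q (from a)) ∷ [])
        listed b (inj₁ eq) = here (trans (sym (strictlyInverseˡ b)) (cong to eq))
        listed b (inj₂ eq) = there (here (trans (sym (strictlyInverseˡ b)) (cong to eq)))
        back : ∀ {w} → from a ~ w → rel a (to w) ≡ true
        back e = ~⇒rel (subst (from a ~_) (sym (strictlyInverseʳ _)) e)

      scheme : DihedralScheme Λ
      scheme = record
        { rel     = rel
        ; irrefl  = λ a → cong (_∧ not ⌊ _≟A_ Λ (inv Λ a) a ⌋) (irr (from a))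
        ; symm    = λ a b → ≡-from-⇔ (~⇒rel ∘ ~-sym ∘ rel⇒~) (~⇒rel ∘ ~-sym ∘ rel⇒~)
        ; twoReg  = two-regular
        ; compSub = λ a b s → trans (tail-cls a) (trans (sound (gmap from rel⇒~ s)) (sym (tail-cls b)))
        ; compSup = λ a b eq → subst₂ (Star (λ x y → rel x y ≡ true)) (strictlyInverseˡ a) (strictlyInverseˡ b)
            (gmap to ~⇒rel-to (complete (trans (sym (tail-cls a)) (trans eq (tail-cls b)))))
        }

      five-regular : FiveRegular Λ
      five-regular u = ↭-length (filterᵇ-↭ (λ a → ⌊ tail Λ a ≟ u ⌋) {ys = map to (Face.members G)} (allArcs-unique Λ)
          (Unique.map⁺ to-injective (Face.members-unique G))
          (λ {a} _ eq → subst (_∈ map to (Face.members G)) (strictlyInverseˡ a)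
            (∈-map⁺ to (Face.reachable⇒∈ G (here refl)
              (complete (trans (cls-rep u) (trans (sym (dec-yes⁻ (tail Λ a ≟ u) eq)) (tail-cls a)))))))
          λ a∈ → allArcs-complete Λ _ , back (∈-map⁻ to a∈))
        where
        G : Face (rep u)
        G = face-of (rep u)
        back : ∀ {a} → (∃ λ w → w ∈ Face.members G × a ≡ to w) → ⌊ tail Λ a ≟ u ⌋ ≡ true
        back (w , w∈ , refl) = dec-yes (tail Λ (to w) ≟ u) (trans (tail-cls (to w))
          (trans (cong cls (strictlyInverseʳ w)) (trans (sym (sound (Face.∈⇒reachable G w∈))) (cls-rep u))))

      iso : IsoTo Γ (Arc Λ) (TrAdj Λ scheme)
      iso = f , λ u v → ≡-from-⇔ (forth u v) (back u v)
        where
        forth : ∀ u v → E u v → TrAdj Λ scheme (to u) (to v) ≡ true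
        forth u v e with v ≟ μ u
        ... | no ne    = cong (_∨ _) (~⇒rel-to (e , ne))
        ... | yes refl = trans (cong (rel (to u) (to (μ u)) ∨_) (dec-yes (_≟A_ Λ (inv Λ (to u)) (to (μ u))) (sym (f-μ u)))) (∨-zeroʳ _)
        back : ∀ u v → TrAdj Λ scheme (to u) (to v) ≡ true → E u v
        back u v r with ∨-true⁻ {rel (to u) (to v)} r
        ... | inj₁ s = subst₂ E (strictlyInverseʳ u) (strictlyInverseʳ v) (proj₁ (rel⇒~ s))
        ... | inj₂ s = subst (E u) (sym (to-injective
          (trans (sym (dec-yes⁻ (_≟A_ Λ (inv Λ (to u)) (to v)) s)) (sym (f-μ u))))) Eμ

    truncation : Σ Multigraph λ Λ → Σ (DihedralScheme Λ) λ D → FiveRegular Λ × IsoTo Γ (Arc Λ) (TrAdj Λ D)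
    truncation = let k , f , f-μ = pairing μ μμ (λ v → E-irr Eμ)
                 in Λ faces k f f-μ , scheme faces k f f-μ , five-regular faces k f f-μ , iso faces k f f-μ

-- The case distinction

-- Needed because `GirthRegular` brings its own girth, which has to be identified with 5.
girth-unique : ∀ Γ {g h} → Girth Γ g → Girth Γ h → g ≡ h
girth-unique Γ {g} {h} ((vs , c) , min) ((ws , d) , min′) with <-cmp g h
... | tri≈ _ eq _ = eq
... | tri< g<h _ _ = contradiction (trans (sym c) (min′ g vs g<h)) λ ()
... | tri> _ _ h<g = contradiction (trans (sym d) (min h ws h<g)) λ ()

module Classification (Γ : Graph) (conn : Connected Γ) (cubic : Cubic Γ) (girth : Girth Γ 5) where

  open Profiles Γ cubic girth
  open Separation Γ conn cubic girth using (petersen; dodecahedron)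
  open Truncation Γ cubic girth using (truncation)

  -- The two inequalities say that `X` differs from `Y` and from `Z`; the edge to `x` is then the
  -- distinguished one. In `matching-z` it is the edge to `z`.
  matching-x : ∀ {X Y Z} → (∀ v → Profile v X Y Z) → X + Z ≢ Y + Z → X + Y ≢ Y + Z → Matching X
  matching-x {X} {Y} {Z} prof y≢ z≢ = record
    { K = Y + Z
    ; μ = λ v → Profile.x (prof v) ; p = λ v → Profile.y (prof v) ; q = λ v → Profile.z (prof v)
    ; nbr = λ v → Profile.nbrs (prof v)
    ; εμ  = λ v → Profile.εx (prof v)
    ; εp  = λ v eq → y≢ (trans (sym (Profile.εy (prof v))) eq)
    ; εq  = λ v eq → z≢ (trans (sym (Profile.εz (prof v))) eq)
    ; Cpq = λ v → Profile.Cyz (prof v)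
    }

  matching-z : ∀ {X Y Z} → (∀ v → Profile v X Y Z) → Y + Z ≢ X + Y → X + Z ≢ X + Y → Matching Z
  matching-z {X} {Y} {Z} prof x≢ y≢ = record
    { K = X + Y
    ; μ = λ v → Profile.z (prof v) ; p = λ v → Profile.x (prof v) ; q = λ v → Profile.y (prof v)
    ; nbr = λ v → N3-rot (N3-rot (Profile.nbrs (prof v)))
    ; εμ  = λ v → Profile.εz (prof v)
    ; εp  = λ v eq → x≢ (trans (sym (Profile.εx (prof v))) eq)
    ; εq  = λ v eq → y≢ (trans (sym (Profile.εy (prof v))) eq)
    ; Cpq = λ v → Profile.Cxy (prof v)
    }

  constant : ∀ {k} → (∀ v → Profile v k k k) → ∀ {a u v} → E a u → E u v → a ≢ v → C a u v ≡ k
  constant prof {u = u} au uv a≢v = C-all-equal (prof u) (E-sym au) uv a≢v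

  -- Matching on the inequalities enumerates the ten sorted triples with entries at most 2. The
  -- triple (0,0,0) is impossible because girth 5 provides a pentagon.
  classify : ∀ {X Y Z} → X ≤ Y → Y ≤ Z → Z ≤ 2 → (∀ v → Profile v X Y Z) →
    ( (∀ v → signature Γ 5 v ≡ 0 ∷ 1 ∷ 1 ∷ [])
      × Σ Multigraph (λ Λ → Σ (DihedralScheme Λ) (λ D → FiveRegular Λ × IsoTo Γ (Arc Λ) (TrAdj Λ D))) )
    ⊎ IsoTo Γ (Fin 10) petersenAdj
    ⊎ IsoTo Γ (Fin 20) dodecahedronAdj
  classify z≤n z≤n z≤n prof =
    let _ , _ , _ , _ , _ , P = some-pentagon
    in contradiction (constant prof (Pentagon.ab P) (Pentagon.bc P) (Pentagon.a≢c P)) (Pentagon⇒C≢0 P)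
  classify z≤n z≤n (s≤s z≤n) prof = inj₁
    ( (λ v → SortedProfile.signature-≡ (sorted z≤n z≤n (prof v)))
    , truncation (matching-z prof (λ ()) (λ ())) (λ v → Profile.Czx (prof v) , Profile.Czy (prof v)) )
  classify z≤n z≤n (s≤s (s≤s z≤n)) prof = ⊥-elim (no-Matching-2-0
    (matching-z prof (λ ()) (λ ())) (λ v → Profile.Czx (prof v) , Profile.Czy (prof v)))
  classify z≤n (s≤s z≤n) (s≤s z≤n) prof = ⊥-elim (no-Matching-0 (matching-x prof (λ ()) (λ ())))
  classify z≤n (s≤s z≤n) (s≤s (s≤s z≤n)) prof = ⊥-elim (no-Matching-0 (matching-x prof (λ ()) (λ ())))
  classify z≤n (s≤s (s≤s z≤n)) (s≤s (s≤s z≤n)) prof = ⊥-elim (no-Matching-0 (matching-x prof (λ ()) (λ ())))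
  classify (s≤s z≤n) (s≤s z≤n) (s≤s z≤n) prof = inj₂ (inj₂ (dodecahedron (constant prof)))
  classify (s≤s z≤n) (s≤s z≤n) (s≤s (s≤s z≤n)) prof = ⊥-elim (no-Matching-2-1
    (matching-z prof (λ ()) (λ ())) (λ v → Profile.Czx (prof v) , Profile.Czy (prof v)))
  classify (s≤s z≤n) (s≤s (s≤s z≤n)) (s≤s (s≤s z≤n)) prof = ⊥-elim (no-Matching-1-2
    (matching-x prof (λ ()) (λ ())) (λ v → Profile.Cxy (prof v) , Profile.Cxz (prof v)))
  classify (s≤s (s≤s z≤n)) (s≤s (s≤s z≤n)) (s≤s (s≤s z≤n)) prof = inj₂ (inj₁ (petersen (constant prof)))

theorem5p1 : (Γ : Graph) → Connected Γ → Cubic Γ → Girth Γ 5 → GirthRegular Γ →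
    ( (∀ (v : Fin (Graph.n Γ)) → signature Γ 5 v ≡ 0 ∷ 1 ∷ 1 ∷ [])
    × Σ Multigraph (λ Λ → Σ (DihedralScheme Λ) (λ D →
    FiveRegular Λ × IsoTo Γ (Arc Λ) (TrAdj Λ D))) )
    ⊎ IsoTo Γ (Fin 10) petersenAdj
    ⊎ IsoTo Γ (Fin 20) dodecahedronAdj
theorem5p1 Γ conn cubic girth (g , girth′ , sig) with girth-unique Γ girth′ girth
... | refl = let _ , _ , _ , X≤Y , Y≤Z , Z≤2 , prof = Profiles.common-profile Γ cubic girth sig
             in Classification.classify Γ conn cubic girth X≤Y Y≤Z Z≤2 prof
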